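{- We have $$\frac{(1-t)(1+t\exp_{q}(x))}{1-t^{2}\exp_{q}(x)\mathrm{Exp}_{q}(x)}=1+\frac{1+t}{2}\sum_{n=1}^{\infty}\left(\frac{1+t^{2}}{1-t^{2}}\right)^{n}P_{n}^{(\mathrm{inv},\mathrm{udr})}\left(q,\frac{2t}{1+t^{2}}\right)\frac{x^{n}}{[n]_{q}!}.$$ Equivalently, $$\sum_{n=1}^{\infty}P_{n}^{(\mathrm{inv},\mathrm{udr})}(q,t)\frac{x^{n}}{[n]_{q}!}=\frac{2}{1+v}\left(\frac{(1-v)\left(1+v\exp_{q}\left(\frac{1-v^{2}}{1+v^{2}}x\right)\right)}{1-v^{2}\exp_{q}\left(\frac{1-v^{2}}{1+v^{2}}x\right)\mathrm{Exp}_{q}\left(\frac{1-v^{2}}{1+v^{2}}x\right)}-1\right),$$ where $v=\frac{1-\sqrt{1-t^{2}}}{t}$.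
   Context: $\mathfrak{S}_n$ is the set of permutations $\pi=\pi_1\cdots\pi_n$ of $[n]=\{1,\dots,n\}$. For $\pi\in\mathfrak{S}_n$, $\mathrm{inv}(\pi)$ is the number of pairs $(i,j)$ with $1\le i<j\le n$ and $\pi_i>\pi_j$. An increasing run of $\pi$ is a maximal increasing consecutive subsequence. A birun of $\pi$ is a maximal monotone (increasing or decreasing) consecutive subsequence of length at least two. An up-down run of $\pi$ is either a birun of $\pi$, or the letter $\pi_1$ if it is an increasing run of length $1$; $\mathrm{udr}(\pi)$ is the number of up-down runs of $\pi$. For $n\ge1$, $P_n^{(\mathrm{inv},\mathrm{udr})}(q,t)=\sum_{\pi\in\mathfrak{S}_n}q^{\mathrm{inv}(\pi)}t^{\mathrm{udr}(\pi)}$. Also $[n]_q!=(1+q)(1+q+q^2)\cdots(1+q+\cdots+q^{n-1})$ (with $[0]_q!=[1]_q!=1$), $\exp_q(x)=\sum_{n\ge0}\frac{x^n}{[n]_q!}$ and $\mathrm{Exp}_q(x)=\sum_{n\ge0}q^{\binom n2}\frac{x^n}{[n]_q!}$. Here $q,t,x$ are indeterminates and the identities are identities of formal power series in $x$: in the first, coefficients are rational functions of $q,t$; in the second, coefficients are formal power series in $t$ over $\mathbb{Q}(q)$, where $\sqrt{1-t^2}$ is the power series in $t$ with constant term $1$, so that $v$ is a formal power series in $t$. -}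

module Defs where

open import Algebra.Bundles using (CommutativeRing)
open import Algebra.Morphism.Structures using (module RingMorphisms)
open import Data.Fin as Fin using (Fin; toℕ)
open import Data.Fin.Permutation as Perm using (Permutation′; _⟨$⟩ʳ_; insert; remove)
open import Data.Fin.Properties as Finₚ using (all?)
open import Data.List using (List; []; _∷_; length; filter; cartesianProduct; cartesianProductWith; allFin; map; foldr)
open import Data.List.Membership.Setoid.Properties using (∈-cartesianProductWith⁺; ∈-resp-≈)
open import Data.List.Membership.Propositional.Properties using (∈-allFin)
open import Data.List.Relation.Unary.Any using (here)
open import Data.List.Relation.Unary.All using ([])
open import Data.List.Relation.Unary.AllPairs using ([]; _∷_)
import Data.List.Membership.Setoid as Membership
import Data.List.Relation.Unary.Unique.Setoid as Unique
import Data.List.Relation.Unary.Unique.Setoid.Properties as Uniqueₚ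
import Data.List.Relation.Unary.Unique.Propositional.Properties as UniqueP
open import Data.Nat as ℕ using (ℕ; zero; suc; z≤n; s≤s; _∸_)
import Data.Nat.Properties as ℕₚ
open import Data.Nat.Combinatorics using (_C_)
open import Data.Product using (∃; _×_; _,_; proj₁; proj₂)
open import Data.Rational as ℚ using (ℚ)
import Data.Rational.Properties as ℚₚ
open import Data.Sum using (_⊎_; inj₁; inj₂; [_,_]′)
open import Data.Empty using (⊥-elim)
open import Level using (0ℓ)
open import Relation.Binary using (Setoid; Decidable)
open import Relation.Binary.PropositionalEquality as ≡ using (_≡_)
open import Relation.Nullary using (¬_; yes; no)
open import Relation.Nullary.Decidable using (_×-dec_; _⊎-dec_; _→-dec_; map′)
import Algebra.Definitions
import Algebra.Definitions.RawMonoid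
import Algebra.Morphism.Construct.Composition as Composition
import Algebra.Morphism.RingMonomorphism as RingMonomorphism
import Algebra.Properties.Ring
import Algebra.Properties.Semiring.Exp
import Algebra.Solver.Ring.NaturalCoefficients.Default as Solver
import Relation.Binary.Reasoning.Setoid as SetoidReasoning

permutationSetoid : ℕ → Setoid 0ℓ 0ℓ
permutationSetoid n = record
  { Carrier = Permutation′ n
  ; _≈_ = Perm._≈_
  ; isEquivalence = record
    { refl = λ _ → ≡.refl
    ; sym = λ π≈ρ i → ≡.sym (π≈ρ i)
    ; trans = λ π≈ρ ρ≈σ i → ≡.trans (π≈ρ i) (ρ≈σ i)
    }
  }

-- insert zero j π is the permutation of Fin (suc n) whose first letter is j
-- and whose remaining letters are in the same relative order as those of π.
permutations : ∀ n → List (Permutation′ n)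
permutations zero    = Perm.id ∷ []
permutations (suc n) = cartesianProductWith (insert Fin.zero) (allFin (suc n)) (permutations n)

private
  insert-cong : ∀ {n} {i j : Fin (suc n)} {π ρ : Permutation′ n} →
                i ≡ j → π Perm.≈ ρ → insert Fin.zero i π Perm.≈ insert Fin.zero j ρ
  insert-cong         ≡.refl π≈ρ Fin.zero    = ≡.refl
  insert-cong {i = i} ≡.refl π≈ρ (Fin.suc k) = ≡.cong (Fin.punchIn i) (π≈ρ k)

  insert-injective : ∀ {n} {i j : Fin (suc n)} {π ρ : Permutation′ n} →
                     insert Fin.zero i π Perm.≈ insert Fin.zero j ρ → i ≡ j × π Perm.≈ ρ
  insert-injective {i = i} eq with eq Fin.zero
  ... | ≡.refl = ≡.refl , λ k → Finₚ.punchIn-injective i _ _ (eq (Fin.suc k))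

-- Every permutation occurs in the list, exactly once.
permutations-complete : ∀ n (π : Permutation′ n) →
                        Membership._∈_ (permutationSetoid n) π (permutations n)
permutations-complete zero    π = here λ ()
permutations-complete (suc n) π =
  ∈-resp-≈ (permutationSetoid (suc n)) {permutations (suc n)}
    {insert Fin.zero (π ⟨$⟩ʳ Fin.zero) (remove Fin.zero π)} {π}
    (Perm.insert-remove Fin.zero π)
    (∈-cartesianProductWith⁺ (≡.setoid (Fin (suc n))) (permutationSetoid n) (permutationSetoid (suc n))
      {f = insert Fin.zero} (λ {i} {j} {ρ} {σ} → insert-cong {i = i} {j} {ρ} {σ})
      (∈-allFin (π ⟨$⟩ʳ Fin.zero)) (permutations-complete n (remove Fin.zero π)))

permutations-unique : ∀ n → Unique.Unique (permutationSetoid n) (permutations n)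
permutations-unique zero    = [] ∷ []
permutations-unique (suc n) =
  Uniqueₚ.cartesianProductWith⁺ (≡.setoid (Fin (suc n))) (permutationSetoid n) (permutationSetoid (suc n))
    (insert Fin.zero) (λ {i} {j} {π} {ρ} → insert-injective {i = i} {j} {π} {ρ})
    (UniqueP.allFin⁺ (suc n)) (permutations-unique n)

countPairs : ∀ {n} {P : Fin n → Fin n → Set} → Decidable P → ℕ
countPairs {n} P? =
  length (filter (λ ij → P? (proj₁ ij) (proj₂ ij)) (cartesianProduct (allFin n) (allFin n)))

module _ {n : ℕ} (π : Permutation′ n) where

  private
    _≤_ _<_ : Fin n → Fin n → Set
    _≤_ = Fin._≤_
    _<_ = Fin._<_

  Inversion : Fin n → Fin n → Set
  Inversion i j = i < j × (π ⟨$⟩ʳ j) < (π ⟨$⟩ʳ i)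

  inversion? : Decidable Inversion
  inversion? i j = (i Fin.<? j) ×-dec ((π ⟨$⟩ʳ j) Fin.<? (π ⟨$⟩ʳ i))

  inv : ℕ
  inv = countPairs inversion?

  -- A nonempty consecutive subsequence π_i ⋯ π_j is given by its end
  -- positions i ≤ j.  Positions and letters are numbered from 0, so the
  -- first letter is at position 0.
  Increasing Decreasing Monotone : Fin n → Fin n → Set
  Increasing i j = ∀ k l → i ≤ k → k < l → l ≤ j → (π ⟨$⟩ʳ k) < (π ⟨$⟩ʳ l)
  Decreasing i j = ∀ k l → i ≤ k → k < l → l ≤ j → (π ⟨$⟩ʳ l) < (π ⟨$⟩ʳ k)
  Monotone i j = Increasing i j ⊎ Decreasing i j

  Maximal : (Fin n → Fin n → Set) → Fin n → Fin n → Set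
  Maximal P i j = P i j × (∀ i′ j′ → i′ ≤ i → j ≤ j′ → P i′ j′ → i′ ≡ i × j′ ≡ j)

  IncreasingRun Birun UpDownRun : Fin n → Fin n → Set
  IncreasingRun i j = i ≤ j × Maximal Increasing i j
  Birun i j = i < j × Maximal Monotone i j
  UpDownRun i j = Birun i j ⊎ (toℕ i ≡ 0 × i ≡ j × IncreasingRun i j)

  increasing? : Decidable Increasing
  increasing? i j = all? λ k → all? λ l →
    (i Fin.≤? k) →-dec ((k Fin.<? l) →-dec ((l Fin.≤? j) →-dec ((π ⟨$⟩ʳ k) Fin.<? (π ⟨$⟩ʳ l))))

  decreasing? : Decidable Decreasing
  decreasing? i j = all? λ k → all? λ l →
    (i Fin.≤? k) →-dec ((k Fin.<? l) →-dec ((l Fin.≤? j) →-dec ((π ⟨$⟩ʳ l) Fin.<? (π ⟨$⟩ʳ k))))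

  maximal? : ∀ {P} → Decidable P → Decidable (Maximal P)
  maximal? P? i j = P? i j ×-dec (all? λ i′ → all? λ j′ →
    (i′ Fin.≤? i) →-dec ((j Fin.≤? j′) →-dec (P? i′ j′ →-dec ((i′ Fin.≟ i) ×-dec (j′ Fin.≟ j)))))

  upDownRun? : Decidable UpDownRun
  upDownRun? i j =
    ((i Fin.<? j) ×-dec maximal? (λ k l → increasing? k l ⊎-dec decreasing? k l) i j)
    ⊎-dec ((toℕ i ℕ.≟ 0) ×-dec ((i Fin.≟ j) ×-dec ((i Fin.≤? j) ×-dec maximal? increasing? i j)))

  udr : ℕ
  udr = countPairs upDownRun?

module Division (R : CommutativeRing 0ℓ 0ℓ) where
  open CommutativeRing R
  open SetoidReasoning setoid
  open Solver commutativeSemiring using (solve; _:=_; _:+_; _:*_)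

  Unit : Carrier → Set
  Unit = Algebra.Definitions.Invertible _≈_ 1# _*_

  infixl 7 _/_[_]

  _/_[_] : (x y : Carrier) → Unit y → Carrier
  x / y [ y⁻¹ , _ ] = x * y⁻¹

  unit : ∀ {x} y → x * y ≈ 1# → Unit x
  unit {x} y xy≈1 = y , trans (*-comm y x) xy≈1 , xy≈1

  unit-resp : ∀ {x y} → x ≈ y → Unit x → Unit y
  unit-resp x≈y (z , _ , xz≈1) = unit z (trans (*-congʳ (sym x≈y)) xz≈1)

  unit-1 : Unit 1#
  unit-1 = unit 1# (*-identityˡ 1#)

  unit-* : ∀ {x y} → Unit x → Unit y → Unit (x * y)
  unit-* {x} {y} (x⁻¹ , _ , p) (y⁻¹ , _ , q) = unit (x⁻¹ * y⁻¹) (begin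
    (x * y) * (x⁻¹ * y⁻¹)
      ≈⟨ solve 4 (λ a b c d → ((a :* b) :* (c :* d)) := ((a :* c) :* (b :* d))) refl x y x⁻¹ y⁻¹ ⟩
    (x * x⁻¹) * (y * y⁻¹) ≈⟨ *-cong p q ⟩
    1# * 1#               ≈⟨ *-identityˡ 1# ⟩
    1#                    ∎)

IsHom : (R S : CommutativeRing 0ℓ 0ℓ) → (CommutativeRing.Carrier R → CommutativeRing.Carrier S) → Set
IsHom R S = RingMorphisms.IsRingHomomorphism (CommutativeRing.rawRing R) (CommutativeRing.rawRing S)

hom-unit : ∀ R S {f} → IsHom R S f → ∀ {x} → Division.Unit R x → Division.Unit S (f x)
hom-unit R S {f} f-hom {x} (y , _ , xy≈1) = Division.unit S (f y) (begin
  f x S.* f y                 ≈⟨ S.sym (*-homo x y) ⟩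
  f (x R.* y)                 ≈⟨ ⟦⟧-cong xy≈1 ⟩
  f R.1#                      ≈⟨ 1#-homo ⟩
  S.1#                        ∎)
  where
  module R = CommutativeRing R
  module S = CommutativeRing S
  open RingMorphisms.IsRingHomomorphism f-hom
  open SetoidReasoning S.setoid

-- The series f₀ + f₁ x + f₂ x² + ⋯ is the sequence f of its coefficients.
module PowerSeries (R : CommutativeRing 0ℓ 0ℓ) where
  open CommutativeRing R
  open Algebra.Properties.Ring ring using (-‿distribˡ-*; -‿distribʳ-*)
  open Algebra.Properties.Semiring.Exp semiring using (_^_)
  open Algebra.Definitions.RawMonoid +-rawMonoid using (sum)
  open Division R using (Unit)
  open SetoidReasoning setoid
  open Solver commutativeSemiring using (solve; _:=_; _:+_; _:*_)

  Series : Set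
  Series = ℕ → Carrier

  infix 4 _≐_ _≋_
  _≐_ : Series → Series → Set
  f ≐ g = ∀ n → f n ≈ g n

  -- Wrapping _≐_ in a record lets Agda infer f and g from f ≋ g.
  record _≋_ (f g : Series) : Set where
    constructor coefficientwise
    field
      at : f ≐ g

  open _≋_ public

  infixl 6 _+ₛ_
  infixl 7 _*ₛ_ _·ₛ_

  _+ₛ_ : Series → Series → Series
  (f +ₛ g) n = f n + g n

  -ₛ_ : Series → Series
  (-ₛ f) n = - f n

  -- Opaque, so that products of series over rings of series are never
  -- normalised; see *ₛ-sum, *ₛ-zero and *ₛ-suc.
  opaque
    _*ₛ_ : Series → Series → Series
    (f *ₛ g) n = sum {suc n} λ i → f (toℕ i) * g (n ∸ toℕ i)

  _·ₛ_ : Carrier → Series → Series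
  (a ·ₛ f) n = a * f n

  const : Carrier → Series
  const a zero    = a
  const a (suc n) = 0#

  0ₛ 1ₛ X : Series
  0ₛ n = 0#
  1ₛ   = const 1#
  X zero          = 0#
  X (suc zero)    = 1#
  X (suc (suc n)) = 0#

  -- f = f₀ + x · tail f, so that tail f is f / x when f₀ = 0.
  tail : Series → Series
  tail f n = f (suc n)

  -- f (a x)
  rescale : Carrier → Series → Series
  rescale a f n = a ^ n * f n

  Σ≥1 : (ℕ → Carrier) → Series
  Σ≥1 a zero    = 0#
  Σ≥1 a (suc n) = a (suc n)

  opaque
    unfolding _*ₛ_

    *ₛ-sum : ∀ f g n → (f *ₛ g) n ≡ sum {suc n} λ i → f (toℕ i) * g (n ∸ toℕ i)
    *ₛ-sum f g n = ≡.refl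

    *ₛ-suc : ∀ f g n → (f *ₛ g) (suc n) ≡ f 0 * g (suc n) + (tail f *ₛ g) n
    *ₛ-suc f g n = ≡.refl

    *ₛ-zero : ∀ f g → (f *ₛ g) 0 ≈ f 0 * g 0
    *ₛ-zero f g = +-identityʳ _

    *ₛ-cong-≤ : ∀ n {f f′ g g′ : Series} → (∀ i → i ℕ.≤ n → f i ≈ f′ i) → (∀ i → i ℕ.≤ n → g i ≈ g′ i) →
                (f *ₛ g) n ≈ (f′ *ₛ g′) n
    *ₛ-cong-≤ zero    p q = +-congʳ (*-cong (p 0 z≤n) (q 0 z≤n))
    *ₛ-cong-≤ (suc n) p q = +-cong (*-cong (p 0 z≤n) (q (suc n) ℕₚ.≤-refl))
      (*ₛ-cong-≤ n (λ i i≤n → p (suc i) (s≤s i≤n)) (λ i i≤n → q i (ℕₚ.m≤n⇒m≤1+n i≤n)))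

    *ₛ-cong : ∀ {f f′ g g′} → f ≐ f′ → g ≐ g′ → f *ₛ g ≐ f′ *ₛ g′
    *ₛ-cong p q n = *ₛ-cong-≤ n (λ i _ → p i) (λ i _ → q i)

    *ₛ-vanishʳ : ∀ n f g → (∀ i → i ℕ.≤ n → g i ≈ 0#) → (f *ₛ g) n ≈ 0#
    *ₛ-vanishʳ zero    f g p = trans (*ₛ-zero f g) (trans (*-congˡ (p 0 z≤n)) (zeroʳ _))
    *ₛ-vanishʳ (suc n) f g p = begin
      f 0 * g (suc n) + (tail f *ₛ g) n
        ≈⟨ +-cong (*-congˡ (p (suc n) ℕₚ.≤-refl)) (*ₛ-vanishʳ n (tail f) g λ i i≤n → p i (ℕₚ.m≤n⇒m≤1+n i≤n)) ⟩
      f 0 * 0# + 0# ≈⟨ +-identityʳ _ ⟩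
      f 0 * 0#      ≈⟨ zeroʳ _ ⟩
      0#            ∎

    *ₛ-distribˡ : ∀ f g h → f *ₛ (g +ₛ h) ≐ (f *ₛ g) +ₛ (f *ₛ h)
    *ₛ-distribˡ f g h zero = begin
      f 0 * (g 0 + h 0) + 0# ≈⟨ +-identityʳ _ ⟩
      f 0 * (g 0 + h 0)      ≈⟨ distribˡ _ _ _ ⟩
      f 0 * g 0 + f 0 * h 0  ≈⟨ +-cong (sym (*ₛ-zero f g)) (sym (*ₛ-zero f h)) ⟩
      (f *ₛ g) 0 + (f *ₛ h) 0 ∎
    *ₛ-distribˡ f g h (suc n) = begin
      f 0 * (g (suc n) + h (suc n)) + (tail f *ₛ (g +ₛ h)) n
        ≈⟨ +-congˡ (*ₛ-distribˡ (tail f) g h n) ⟩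
      f 0 * (g (suc n) + h (suc n)) + ((tail f *ₛ g) n + (tail f *ₛ h) n)
        ≈⟨ solve 5 (λ a b c d e → (a :* (b :+ c) :+ (d :+ e)) := ((a :* b :+ d) :+ (a :* c :+ e))) refl _ _ _ _ _ ⟩
      (f *ₛ g) (suc n) + (f *ₛ h) (suc n) ∎

    *ₛ-sucʳ : ∀ f g n → (f *ₛ g) (suc n) ≈ f (suc n) * g 0 + (f *ₛ tail g) n
    *ₛ-sucʳ f g zero = begin
      f 0 * g 1 + (f 1 * g 0 + 0#)
        ≈⟨ +-congˡ (+-identityʳ _) ⟩
      f 0 * g 1 + f 1 * g 0
        ≈⟨ +-comm _ _ ⟩
      f 1 * g 0 + f 0 * g 1
        ≈⟨ +-congˡ (sym (+-identityʳ _)) ⟩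
      f 1 * g 0 + (f 0 * g 1 + 0#) ∎
    *ₛ-sucʳ f g (suc n) = begin
      f 0 * g (suc (suc n)) + (tail f *ₛ g) (suc n)
        ≈⟨ +-congˡ (*ₛ-sucʳ (tail f) g n) ⟩
      f 0 * g (suc (suc n)) + (f (suc (suc n)) * g 0 + (tail f *ₛ tail g) n)
        ≈⟨ solve 3 (λ a b c → (a :+ (b :+ c)) := (b :+ (a :+ c))) refl _ _ _ ⟩
      f (suc (suc n)) * g 0 + (f *ₛ tail g) (suc n) ∎

    *ₛ-comm : ∀ f g → f *ₛ g ≐ g *ₛ f
    *ₛ-comm f g zero    = +-congʳ (*-comm _ _)
    *ₛ-comm f g (suc n) = begin
      f 0 * g (suc n) + (tail f *ₛ g) n ≈⟨ +-cong (*-comm _ _) (*ₛ-comm (tail f) g n) ⟩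
      g (suc n) * f 0 + (g *ₛ tail f) n ≈⟨ sym (*ₛ-sucʳ g f n) ⟩
      (g *ₛ f) (suc n)                  ∎

    *ₛ-distribʳ : ∀ f g h → (g +ₛ h) *ₛ f ≐ (g *ₛ f) +ₛ (h *ₛ f)
    *ₛ-distribʳ f g h n = begin
      ((g +ₛ h) *ₛ f) n         ≈⟨ *ₛ-comm (g +ₛ h) f n ⟩
      (f *ₛ (g +ₛ h)) n         ≈⟨ *ₛ-distribˡ f g h n ⟩
      (f *ₛ g) n + (f *ₛ h) n   ≈⟨ +-cong (*ₛ-comm f g n) (*ₛ-comm f h n) ⟩
      (g *ₛ f) n + (h *ₛ f) n   ∎

    ·ₛ-*ₛ-assoc : ∀ a f g → (a ·ₛ f) *ₛ g ≐ a ·ₛ (f *ₛ g)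
    ·ₛ-*ₛ-assoc a f g zero    = begin
      a * f 0 * g 0 + 0#   ≈⟨ +-identityʳ _ ⟩
      a * f 0 * g 0        ≈⟨ *-assoc _ _ _ ⟩
      a * (f 0 * g 0)      ≈⟨ *-congˡ (sym (*ₛ-zero f g)) ⟩
      a * (f *ₛ g) 0       ∎
    ·ₛ-*ₛ-assoc a f g (suc n) = begin
      a * f 0 * g (suc n) + ((a ·ₛ tail f) *ₛ g) n ≈⟨ +-congˡ (·ₛ-*ₛ-assoc a (tail f) g n) ⟩
      a * f 0 * g (suc n) + a * (tail f *ₛ g) n
        ≈⟨ solve 4 (λ a b c d → (a :* b :* c :+ a :* d) := (a :* (b :* c :+ d))) refl _ _ _ _ ⟩
      a * (f *ₛ g) (suc n) ∎

    *ₛ-assoc : ∀ f g h → (f *ₛ g) *ₛ h ≐ f *ₛ (g *ₛ h)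
    *ₛ-assoc f g h zero = begin
      ((f *ₛ g) *ₛ h) 0   ≈⟨ *ₛ-zero (f *ₛ g) h ⟩
      (f *ₛ g) 0 * h 0    ≈⟨ *-congʳ (*ₛ-zero f g) ⟩
      f 0 * g 0 * h 0     ≈⟨ *-assoc _ _ _ ⟩
      f 0 * (g 0 * h 0)   ≈⟨ *-congˡ (sym (*ₛ-zero g h)) ⟩
      f 0 * (g *ₛ h) 0    ≈⟨ sym (*ₛ-zero f (g *ₛ h)) ⟩
      (f *ₛ (g *ₛ h)) 0   ∎
    *ₛ-assoc f g h (suc n) = begin
      (f *ₛ g) 0 * h (suc n) + (((f 0 ·ₛ tail g) +ₛ (tail f *ₛ g)) *ₛ h) n
        ≈⟨ +-cong (*-congʳ (*ₛ-zero f g)) (*ₛ-distribʳ h (f 0 ·ₛ tail g) (tail f *ₛ g) n) ⟩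
      f 0 * g 0 * h (suc n) + (((f 0 ·ₛ tail g) *ₛ h) n + ((tail f *ₛ g) *ₛ h) n)
        ≈⟨ +-congˡ (+-cong (·ₛ-*ₛ-assoc (f 0) (tail g) h n) (*ₛ-assoc (tail f) g h n)) ⟩
      f 0 * g 0 * h (suc n) + (f 0 * (tail g *ₛ h) n + (tail f *ₛ (g *ₛ h)) n)
        ≈⟨ solve 5 (λ a b c d e → (a :* b :* c :+ (a :* d :+ e)) := (a :* (b :* c :+ d) :+ e)) refl _ _ _ _ _ ⟩
      (f *ₛ (g *ₛ h)) (suc n) ∎

    const-*ₛ : ∀ a f → const a *ₛ f ≐ a ·ₛ f
    const-*ₛ a f zero    = +-identityʳ _
    const-*ₛ a f (suc n) = begin
      a * f (suc n) + (0ₛ *ₛ f) n ≈⟨ +-congˡ (*ₛ-comm 0ₛ f n) ⟩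
      a * f (suc n) + (f *ₛ 0ₛ) n ≈⟨ +-congˡ (*ₛ-vanishʳ n f 0ₛ λ _ _ → refl) ⟩
      a * f (suc n) + 0#          ≈⟨ +-identityʳ _ ⟩
      a * f (suc n)               ∎

    *ₛ-identityˡ : ∀ f → 1ₛ *ₛ f ≐ f
    *ₛ-identityˡ f n = trans (const-*ₛ 1# f n) (*-identityˡ _)

  seriesRing : CommutativeRing 0ℓ 0ℓ
  seriesRing = record
    { Carrier = Series
    ; _≈_ = _≋_
    ; _+_ = _+ₛ_
    ; _*_ = _*ₛ_
    ; -_ = -ₛ_
    ; 0# = 0ₛ
    ; 1# = 1ₛ
    ; isCommutativeRing = record
      { isRing = record
        { +-isAbelianGroup = record
          { isGroup = record
            { isMonoid = record
              { isSemigroup = record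
                { isMagma = record
                  { isEquivalence = record
                    { refl = coefficientwise λ _ → refl
                    ; sym = λ p → coefficientwise λ n → sym (at p n)
                    ; trans = λ p q → coefficientwise λ n → trans (at p n) (at q n)
                    }
                  ; ∙-cong = λ p q → coefficientwise λ n → +-cong (at p n) (at q n)
                  }
                ; assoc = λ f g h → coefficientwise λ n → +-assoc (f n) (g n) (h n)
                }
              ; identity = (λ f → coefficientwise λ n → +-identityˡ (f n))
                         , (λ f → coefficientwise λ n → +-identityʳ (f n))
              }
            ; inverse = (λ f → coefficientwise λ n → -‿inverseˡ (f n))
                      , (λ f → coefficientwise λ n → -‿inverseʳ (f n))
            ; ⁻¹-cong = λ p → coefficientwise λ n → -‿cong (at p n)
            }
          ; comm = λ f g → coefficientwise λ n → +-comm (f n) (g n)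
          }
        ; *-cong = λ p q → coefficientwise (*ₛ-cong (at p) (at q))
        ; *-assoc = λ f g h → coefficientwise (*ₛ-assoc f g h)
        ; *-identity = (λ f → coefficientwise (*ₛ-identityˡ f))
                     , (λ f → coefficientwise λ n → trans (*ₛ-comm f 1ₛ n) (*ₛ-identityˡ f n))
        ; distrib = (λ f g h → coefficientwise (*ₛ-distribˡ f g h))
                  , (λ f g h → coefficientwise (*ₛ-distribʳ f g h))
        }
      ; *-comm = λ f g → coefficientwise (*ₛ-comm f g)
      }
    }

  const-cong : ∀ {a b} → a ≈ b → const a ≐ const b
  const-cong a≈b zero    = a≈b
  const-cong a≈b (suc n) = refl

  const-+ : ∀ a b → const (a + b) ≐ const a +ₛ const b
  const-+ a b zero    = refl
  const-+ a b (suc n) = sym (+-identityʳ 0#)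

  const-* : ∀ a b → const (a * b) ≐ const a *ₛ const b
  const-* a b zero    = sym (*ₛ-zero (const a) (const b))
  const-* a b (suc n) = sym (trans (const-*ₛ a (const b) (suc n)) (zeroʳ a))

  const-neg : ∀ a → const (- a) ≐ -ₛ const a
  const-neg a zero    = refl
  const-neg a (suc n) = sym (trans (sym (+-identityˡ (- 0#))) (-‿inverseʳ 0#))

  const-0 : const 0# ≐ 0ₛ
  const-0 zero    = refl
  const-0 (suc n) = refl

  const-hom : IsHom R seriesRing const
  const-hom = record
    { isSemiringHomomorphism = record
      { isNearSemiringHomomorphism = record
        { +-isMonoidHomomorphism = record
          { isMagmaHomomorphism = record
            { isRelHomomorphism = record { cong = λ p → coefficientwise (const-cong p) }
            ; homo = λ a b → coefficientwise (const-+ a b)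
            }
          ; ε-homo = coefficientwise const-0
          }
        ; *-homo = λ a b → coefficientwise (const-* a b)
        }
      ; 1#-homo = coefficientwise λ _ → refl
      }
    ; -‿homo = λ a → coefficientwise (const-neg a)
    }

  -- Recursive definitions of series: if each coefficient of Φ f depends only
  -- on earlier coefficients of f, then Φ has a fixed point.
  private
    Causal : (Series → Series) → Set
    Causal Φ = ∀ n f g → (∀ i → i ℕ.< n → f i ≈ g i) → Φ f n ≈ Φ g n

    iterate : (Series → Series) → ℕ → Series
    iterate Φ zero    = 0ₛ
    iterate Φ (suc k) = Φ (iterate Φ k)

    fix : (Series → Series) → Series
    fix Φ n = iterate Φ (suc n) n

    iterate-stable : ∀ {Φ} → Causal Φ → ∀ k l n → n ℕ.< k → n ℕ.< l → iterate Φ k n ≈ iterate Φ l n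
    iterate-stable causal (suc k) (suc l) n (s≤s n≤k) (s≤s n≤l) = causal n _ _ λ i i<n →
      iterate-stable causal k l i (ℕₚ.<-≤-trans i<n n≤k) (ℕₚ.<-≤-trans i<n n≤l)

    fix-fixed : ∀ {Φ} → Causal Φ → fix Φ ≐ Φ (fix Φ)
    fix-fixed {Φ} causal n = causal n _ _ λ i i<n →
      iterate-stable causal n (suc i) i i<n ℕₚ.≤-refl

    inverseStep : Carrier → Series → Series → Series
    inverseStep c f g zero    = c
    inverseStep c f g (suc n) = - (c * (tail f *ₛ g) n)

    inverseStep-causal : ∀ c f → Causal (inverseStep c f)
    inverseStep-causal c f zero    g h p = refl
    inverseStep-causal c f (suc n) g h p =
      -‿cong (*-congˡ (*ₛ-cong-≤ n {tail f} {tail f} {g} {h} (λ _ _ → refl) (λ i i≤n → p i (s≤s i≤n))))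

  opaque
    unfolding _*ₛ_

    unit-series : ∀ {f} → Unit (f 0) → Division.Unit seriesRing f
    unit-series {f} (c , _ , f₀c≈1) = Division.unit seriesRing g (coefficientwise f*g≐1)
      where
      g : Series
      g = fix (inverseStep c f)

      f*g≐1 : f *ₛ g ≐ 1ₛ
      f*g≐1 zero    = trans (*ₛ-zero f g) f₀c≈1
      f*g≐1 (suc n) = begin
        f 0 * g (suc n) + y ≈⟨ +-congʳ (*-congˡ (fix-fixed (inverseStep-causal c f) (suc n))) ⟩
        f 0 * - (c * y) + y
          ≈⟨ +-congʳ (trans (sym (-‿distribʳ-* _ _)) (-‿cong (sym (*-assoc _ _ _)))) ⟩
        - (f 0 * c * y) + y ≈⟨ +-congʳ (-‿cong (trans (*-congʳ f₀c≈1) (*-identityˡ y))) ⟩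
        - y + y             ≈⟨ -‿inverseˡ y ⟩
        0#                  ∎
        where
        y : Carrier
        y = (tail f *ₛ g) n

  -- Square roots: if f = 1 + x φ, then s = 1 + x w has s² = f exactly when
  -- 2 w = φ - x w².
  module SquareRoot (½ : Carrier) (½+½≈1 : ½ + ½ ≈ 1#) where

    private
      step : Series → Series → Series
      step f w zero    = ½ * f 1
      step f w (suc n) = ½ * (f (suc (suc n)) - (w *ₛ w) n)

      step-causal : ∀ f → Causal (step f)
      step-causal f zero    g h p = refl
      step-causal f (suc n) g h p = *-congˡ (+-congˡ (-‿cong
        (*ₛ-cong-≤ n {g} {h} {g} {h} (λ i i≤n → p i (s≤s i≤n)) (λ i i≤n → p i (s≤s i≤n)))))

    √ : Series → Series
    √ f zero    = 1#
    √ f (suc n) = fix (step f) n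

    √-square : ∀ {f} → f 0 ≈ 1# → √ f *ₛ √ f ≐ f
    √-square {f} f₀≈1 zero = trans (*ₛ-zero (√ f) (√ f)) (trans (*-identityˡ 1#) (sym f₀≈1))
    √-square {f} f₀≈1 (suc n) = trans (reflexive (*ₛ-suc (√ f) (√ f) n))
      (trans (+-cong (*-identityˡ (w n)) (lower n)) (combine n))
      where
      w : Series
      w = fix (step f)

      double : ∀ y → ½ * y + ½ * y ≈ y
      double y = trans (sym (distribʳ y ½ ½)) (trans (*-congʳ ½+½≈1) (*-identityˡ y))

      rest : Series
      rest zero    = w 0
      rest (suc n) = w (suc n) + (w *ₛ w) n

      lower : (w *ₛ √ f) ≐ rest
      lower zero    = trans (*ₛ-zero w (√ f)) (*-identityʳ (w 0))
      lower (suc n) = trans (*ₛ-sucʳ w (√ f) n) (+-congʳ (*-identityʳ (w (suc n))))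

      combine : ∀ n → w n + rest n ≈ f (suc n)
      combine zero    = double (f 1)
      combine (suc n) = begin
        w (suc n) + (w (suc n) + y) ≈⟨ sym (+-assoc _ _ _) ⟩
        w (suc n) + w (suc n) + y   ≈⟨ +-congʳ (+-cong w≈ w≈) ⟩
        ½ * (z - y) + ½ * (z - y) + y ≈⟨ +-congʳ (double (z - y)) ⟩
        z - y + y                   ≈⟨ +-assoc _ _ _ ⟩
        z + (- y + y)               ≈⟨ +-congˡ (-‿inverseˡ y) ⟩
        z + 0#                      ≈⟨ +-identityʳ z ⟩
        z                           ∎
        where
        y = (w *ₛ w) n
        z = f (suc (suc n))
        w≈ : w (suc n) ≈ ½ * (z - y)
        w≈ = fix-fixed (step-causal f) (suc n)

  X*ₛ-suc : ∀ f n → (X *ₛ f) (suc n) ≈ f n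
  X*ₛ-suc f n = begin
    (X *ₛ f) (suc n) ≡⟨ *ₛ-suc X f n ⟩
    0# * f (suc n) + (tail X *ₛ f) n
      ≈⟨ +-cong (zeroˡ _) (*ₛ-cong {tail X} {1ₛ} {f} {f} (λ { zero → refl ; (suc _) → refl }) (λ _ → refl) n) ⟩
    0# + (1ₛ *ₛ f) n ≈⟨ +-identityˡ _ ⟩
    (1ₛ *ₛ f) n      ≈⟨ *ₛ-identityˡ f n ⟩
    f n              ∎

  X*ₛ-tail : ∀ f → f 0 ≈ 0# → X *ₛ tail f ≐ f
  X*ₛ-tail f f₀≈0 zero    = trans (*ₛ-zero X (tail f)) (trans (zeroˡ _) (sym f₀≈0))
  X*ₛ-tail f f₀≈0 (suc n) = X*ₛ-suc (tail f) n

record IntegralDomain : Set₁ where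
  field
    commutativeRing : CommutativeRing 0ℓ 0ℓ
  open CommutativeRing commutativeRing public
  field
    _≟_       : Decidable _≈_
    1≉0       : ¬ 1# ≈ 0#
    *-nonZero : ∀ {x y} → ¬ x ≈ 0# → ¬ y ≈ 0# → ¬ x * y ≈ 0#

record Field : Set₁ where
  field
    commutativeRing : CommutativeRing 0ℓ 0ℓ
  open CommutativeRing commutativeRing public
  open Division commutativeRing public
  field
    _≟_     : Decidable _≈_
    1≉0     : ¬ 1# ≈ 0#
    inverse : ∀ {x} → ¬ x ≈ 0# → Unit x

  integralDomain : IntegralDomain
  integralDomain = record
    { commutativeRing = commutativeRing
    ; _≟_ = _≟_
    ; 1≉0 = 1≉0
    ; *-nonZero = λ {x} {y} x≉0 y≉0 xy≈0 →
        let (z , zx≈1 , _) = inverse x≉0 in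
        y≉0 (begin
          y           ≈⟨ sym (*-identityˡ y) ⟩
          1# * y      ≈⟨ *-congʳ (sym zx≈1) ⟩
          z * x * y   ≈⟨ *-assoc z x y ⟩
          z * (x * y) ≈⟨ *-congˡ xy≈0 ⟩
          z * 0#      ≈⟨ zeroʳ z ⟩
          0#          ∎)
    }
    where open SetoidReasoning setoid

rationalField : Field
rationalField = record
  { commutativeRing = ℚₚ.+-*-commutativeRing
  ; _≟_ = ℚₚ._≟_
  ; 1≉0 = λ ()
  ; inverse = λ {p} p≢0 →
      let instance p-nonZero = ℚ.≢-nonZero p≢0 in
      ℚ.1/ p , ℚₚ.*-inverseˡ p , ℚₚ.*-inverseʳ p
  }

-- Polynomials over D are the power series with finitely many nonzero
-- coefficients.
module Polynomials (D : IntegralDomain) where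
  open IntegralDomain D
  open PowerSeries commutativeRing hiding (_≋_; coefficientwise; at)
  private
    module S where
      open PowerSeries commutativeRing public using (_≋_; coefficientwise; at)
      open CommutativeRing seriesRing public

  record Polynomial : Set where
    no-eta-equality
    constructor polynomial
    field
      coeff    : Series
      bound    : ℕ
      vanishes : ∀ n → bound ℕ.≤ n → coeff n ≈ 0#

  open Polynomial public

  infix 4 _≈ₚ_
  record _≈ₚ_ (p r : Polynomial) : Set where
    constructor coefficientwise
    field
      at : coeff p ≐ coeff r

  open _≈ₚ_ public

  private
    -0≈0 : - 0# ≈ 0#
    -0≈0 = trans (sym (+-identityˡ _)) (-‿inverseʳ 0#)

    vanish-+ : ∀ {f g : Series} {a b} → (∀ n → a ℕ.≤ n → f n ≈ 0#) → (∀ n → b ℕ.≤ n → g n ≈ 0#) →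
               ∀ n → a ℕ.+ b ℕ.≤ n → f n + g n ≈ 0#
    vanish-+ {a = a} {b} p q n a+b≤n = trans
      (+-cong (p n (ℕₚ.≤-trans (ℕₚ.m≤m+n a b) a+b≤n)) (q n (ℕₚ.≤-trans (ℕₚ.m≤n+m b a) a+b≤n)))
      (+-identityˡ 0#)

    vanish-*ˡ : ∀ n f (g : Series) → (∀ i → f i ≈ 0#) → (f *ₛ g) n ≈ 0#
    vanish-*ˡ n f g p = trans (*ₛ-comm f g n) (*ₛ-vanishʳ n g f λ i _ → p i)

    vanish-* : ∀ a {b} (f g : Series) → (∀ n → a ℕ.≤ n → f n ≈ 0#) → (∀ n → b ℕ.≤ n → g n ≈ 0#) →
               ∀ n → a ℕ.+ b ℕ.≤ n → (f *ₛ g) n ≈ 0#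
    vanish-* zero    f g p q n       _           = vanish-*ˡ n f g λ i → p i z≤n
    vanish-* (suc a) {b} f g p q (suc n) (s≤s a+b≤n) = trans (reflexive (*ₛ-suc f g n)) (trans
      (+-cong (trans (*-congˡ (q (suc n) (ℕₚ.m≤n⇒m≤1+n (ℕₚ.≤-trans (ℕₚ.m≤n+m b a) a+b≤n)))) (zeroʳ _))
              (vanish-* a (tail f) g (λ m a≤m → p (suc m) (s≤s a≤m)) q n a+b≤n))
      (+-identityˡ 0#))

  constₚ : Carrier → Polynomial
  constₚ a = polynomial (const a) 1 λ { (suc n) _ → refl }

  Xₚ : Polynomial
  Xₚ = polynomial X 2 λ { (suc zero) (s≤s ()) ; (suc (suc n)) _ → refl }

  polynomialRing : CommutativeRing 0ℓ 0ℓ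
  polynomialRing = record
    { Carrier = Polynomial
    ; _≈_ = _≈ₚ_
    ; _+_ = λ p r → polynomial (coeff p +ₛ coeff r) (bound p ℕ.+ bound r) (vanish-+ (vanishes p) (vanishes r))
    ; _*_ = λ p r → polynomial (coeff p *ₛ coeff r) (bound p ℕ.+ bound r)
                      (vanish-* (bound p) (coeff p) (coeff r) (vanishes p) (vanishes r))
    ; -_ = λ p → polynomial (-ₛ coeff p) (bound p) λ n b≤n → trans (-‿cong (vanishes p n b≤n)) -0≈0
    ; 0# = polynomial 0ₛ 0 λ _ _ → refl
    ; 1# = constₚ 1#
    ; isCommutativeRing = RingMonomorphism.isCommutativeRing
        {R₂ = CommutativeRing.rawRing seriesRing} {⟦_⟧ = coeff}
        (record
          { isRingHomomorphism = record
            { isSemiringHomomorphism = record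
              { isNearSemiringHomomorphism = record
                { +-isMonoidHomomorphism = record
                  { isMagmaHomomorphism = record
                    { isRelHomomorphism = record { cong = λ p → S.coefficientwise (at p) }
                    ; homo = λ _ _ → S.refl
                    }
                  ; ε-homo = S.refl
                  }
                ; *-homo = λ _ _ → S.refl
                }
              ; 1#-homo = S.refl
              }
            ; -‿homo = λ _ → S.refl
            }
          ; injective = λ p → coefficientwise (S.at p)
          })
        S.isCommutativeRing
    }

  open CommutativeRing polynomialRing using ()
    renaming (0# to 0ₚ)

  constₚ-hom : IsHom commutativeRing polynomialRing constₚ
  constₚ-hom = record
    { isSemiringHomomorphism = record
      { isNearSemiringHomomorphism = record
        { +-isMonoidHomomorphism = record
          { isMagmaHomomorphism = record
            { isRelHomomorphism = record { cong = λ a≈b → coefficientwise (const-cong a≈b) }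
            ; homo = λ a b → coefficientwise (const-+ a b)
            }
          ; ε-homo = coefficientwise const-0
          }
        ; *-homo = λ a b → coefficientwise (const-* a b)
        }
      ; 1#-homo = coefficientwise λ _ → refl
      }
    ; -‿homo = λ a → coefficientwise (const-neg a)
    }

  private
    _≟ₚ_ : Decidable _≈ₚ_
    p ≟ₚ r = map′ (λ eq → coefficientwise λ n → [ (λ n<N → eq n<N) , (λ N≤n → trans (vanishes p n (ℕₚ.≤-trans (ℕₚ.m≤m+n _ _) N≤n))
                                                 (sym (vanishes r n (ℕₚ.≤-trans (ℕₚ.m≤n+m _ (bound p)) N≤n)))) ]′
                                   (ℕₚ.<-≤-connex n N))
                  (λ eq {n} _ → at eq n)
                  (ℕₚ.allUpTo? (λ n → coeff p n ≟ coeff r n) N)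
      where
      N = bound p ℕ.+ bound r

    Lowest : Series → Set
    Lowest f = ∃ λ m → (¬ f m ≈ 0#) × (∀ i → i ℕ.< m → f i ≈ 0#)

    search : ∀ f N → (∀ i → i ℕ.< N → f i ≈ 0#) ⊎ Lowest f
    search f zero = inj₁ λ _ ()
    search f (suc N) with search f N
    ... | inj₂ low = inj₂ low
    ... | inj₁ z with f N ≟ 0#
    ...   | no  fN≉0 = inj₂ (N , fN≉0 , z)
    ...   | yes fN≈0 = inj₁ λ i i<1+N → [ z i , (λ { ≡.refl → fN≈0 }) ]′ (ℕₚ.m<1+n⇒m<n∨m≡n i<1+N)

    lowest : ∀ p → ¬ p ≈ₚ 0ₚ → Lowest (coeff p)
    lowest p p≉0 with search (coeff p) (bound p)
    ... | inj₂ low = low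
    ... | inj₁ z = ⊥-elim (p≉0 (coefficientwise λ n → [ z n , vanishes p n ]′ (ℕₚ.<-≤-connex n (bound p))))

    *ₛ-lowest : ∀ m k f g → (∀ i → i ℕ.< m → f i ≈ 0#) → (∀ i → i ℕ.< k → g i ≈ 0#) →
                (f *ₛ g) (m ℕ.+ k) ≈ f m * g k
    *ₛ-lowest zero    zero    f g p q = *ₛ-zero f g
    *ₛ-lowest zero    (suc k) f g p q = trans (reflexive (*ₛ-suc f g k)) (trans
      (+-congˡ (*ₛ-vanishʳ k (tail f) g λ i i≤k → q i (s≤s i≤k))) (+-identityʳ _))
    *ₛ-lowest (suc m) k       f g p q = trans (reflexive (*ₛ-suc f g (m ℕ.+ k))) (trans
      (+-cong (trans (*-congʳ (p 0 (s≤s z≤n))) (zeroˡ _))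
              (*ₛ-lowest m k (tail f) g (λ i i<m → p (suc i) (s≤s i<m)) q))
      (+-identityˡ _))

  polynomialDomain : IntegralDomain
  polynomialDomain = record
    { commutativeRing = polynomialRing
    ; _≟_ = _≟ₚ_
    ; 1≉0 = λ 1≈0 → 1≉0 (at 1≈0 0)
    ; *-nonZero = λ {p} {r} p≉0 r≉0 pr≈0 →
        let (m , pm≉0 , p<m) = lowest p p≉0
            (k , rk≉0 , r<k) = lowest r r≉0
        in *-nonZero pm≉0 rk≉0 (trans (sym (*ₛ-lowest m k (coeff p) (coeff r) p<m r<k)) (at pr≈0 (m ℕ.+ k)))
    }

module Fractions (D : IntegralDomain) where
  open IntegralDomain D
  open Algebra.Properties.Ring ring using (-‿distribˡ-*; -‿distribʳ-*)
  open Solver commutativeSemiring using (solve; _:=_; _:+_; _:*_; con)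
  open SetoidReasoning setoid

  record Fraction : Set where
    no-eta-equality
    pattern
    constructor fraction
    field
      num   : Carrier
      den   : Carrier
      den≉0 : ¬ den ≈ 0#

  open Fraction public

  private
    cancel : ∀ x {y z} → ¬ x ≈ 0# → x * y ≈ x * z → y ≈ z
    cancel x {y} {z} x≉0 xy≈xz with (y - z) ≟ 0#
    ... | yes y-z≈0 = (begin
      y             ≈⟨ sym (+-identityʳ y) ⟩
      y + 0#        ≈⟨ +-congˡ (sym (-‿inverseˡ z)) ⟩
      y + (- z + z) ≈⟨ sym (+-assoc y (- z) z) ⟩
      y - z + z     ≈⟨ +-congʳ y-z≈0 ⟩
      0# + z        ≈⟨ +-identityˡ z ⟩
      z             ∎)
    ... | no  y-z≉0 = ⊥-elim (*-nonZero x≉0 y-z≉0 (begin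
      x * (y - z)       ≈⟨ distribˡ x y (- z) ⟩
      x * y + x * - z   ≈⟨ +-congˡ (sym (-‿distribʳ-* x z)) ⟩
      x * y - x * z     ≈⟨ +-congʳ xy≈xz ⟩
      x * z - x * z     ≈⟨ -‿inverseʳ _ ⟩
      0#                ∎))

  infix  4 _≈ᶠ_
  infixl 6 _+ᶠ_
  infixl 7 _*ᶠ_

  record _≈ᶠ_ (p r : Fraction) : Set where
    constructor cross
    field
      uncross : num p * den r ≈ num r * den p

  open _≈ᶠ_ public

  -- The operations are opaque so that the nested constructions below are
  -- never normalised; their laws are those of fractionRing.
  opaque
    _+ᶠ_ _*ᶠ_ : Fraction → Fraction → Fraction
    p +ᶠ r = fraction (num p * den r + num r * den p) (den p * den r) (*-nonZero (den≉0 p) (den≉0 r))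
    p *ᶠ r = fraction (num p * num r) (den p * den r) (*-nonZero (den≉0 p) (den≉0 r))

    -ᶠ_ : Fraction → Fraction
    -ᶠ p = fraction (- num p) (den p) (den≉0 p)

  embed : Carrier → Fraction
  embed x = fraction x 1# 1≉0

  private
    infix 4 _~_
    _~_ : Fraction → Fraction → Set
    p ~ r = num p * den r ≈ num r * den p

    ~-trans : ∀ p r s → p ~ r → r ~ s → p ~ s
    ~-trans (fraction a b _) (fraction c d d≉0) (fraction e f _) ad≈cb cf≈ed = cancel d d≉0 (begin
      d * (a * f) ≈⟨ solve 3 (λ a d f → d :* (a :* f) := (a :* d) :* f) refl a d f ⟩
      a * d * f   ≈⟨ *-congʳ ad≈cb ⟩
      c * b * f   ≈⟨ solve 3 (λ c b f → c :* b :* f := (c :* f) :* b) refl c b f ⟩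
      c * f * b   ≈⟨ *-congʳ cf≈ed ⟩
      e * d * b   ≈⟨ solve 3 (λ e d b → e :* d :* b := d :* (e :* b)) refl e d b ⟩
      d * (e * b) ∎)

    opaque
      unfolding _+ᶠ_ _*ᶠ_ -ᶠ_

      +ᶠ-cong : ∀ p p′ r r′ → p ~ p′ → r ~ r′ → p +ᶠ r ~ p′ +ᶠ r′
      +ᶠ-cong (fraction a b _) (fraction a′ b′ _) (fraction c d _) (fraction c′ d′ _) p r = begin
        (a * d + c * b) * (b′ * d′)
          ≈⟨ solve 6 (λ a b c d b′ d′ → (a :* d :+ c :* b) :* (b′ :* d′) :=
               (a :* b′) :* (d :* d′) :+ (c :* d′) :* (b :* b′)) refl a b c d b′ d′ ⟩
        a * b′ * (d * d′) + c * d′ * (b * b′) ≈⟨ +-cong (*-congʳ p) (*-congʳ r) ⟩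
        a′ * b * (d * d′) + c′ * d * (b * b′)
          ≈⟨ solve 6 (λ a′ b c′ d b′ d′ → (a′ :* b) :* (d :* d′) :+ (c′ :* d) :* (b :* b′) :=
               (a′ :* d′ :+ c′ :* b′) :* (b :* d)) refl a′ b c′ d b′ d′ ⟩
        (a′ * d′ + c′ * b′) * (b * d) ∎

      *ᶠ-cong : ∀ p p′ r r′ → p ~ p′ → r ~ r′ → p *ᶠ r ~ p′ *ᶠ r′
      *ᶠ-cong (fraction a b _) (fraction a′ b′ _) (fraction c d _) (fraction c′ d′ _) p r = begin
        (a * c) * (b′ * d′)
          ≈⟨ solve 4 (λ a c b′ d′ → (a :* c) :* (b′ :* d′) := (a :* b′) :* (c :* d′)) refl a c b′ d′ ⟩
        (a * b′) * (c * d′) ≈⟨ *-cong p r ⟩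
        (a′ * b) * (c′ * d)
          ≈⟨ solve 4 (λ a c b′ d′ → (a :* b′) :* (c :* d′) := (a :* c) :* (b′ :* d′)) refl a′ c′ b d ⟩
        (a′ * c′) * (b * d) ∎

      -ᶠ-cong : ∀ p r → p ~ r → -ᶠ p ~ -ᶠ r
      -ᶠ-cong (fraction a b _) (fraction c d _) ad≈cb = begin
        - a * d   ≈⟨ sym (-‿distribˡ-* a d) ⟩
        - (a * d) ≈⟨ -‿cong ad≈cb ⟩
        - (c * b) ≈⟨ -‿distribˡ-* c b ⟩
        - c * b   ∎

      +ᶠ-assoc : ∀ p r s → (p +ᶠ r) +ᶠ s ~ p +ᶠ (r +ᶠ s)
      +ᶠ-assoc (fraction a b _) (fraction c d _) (fraction e f _) = solve 6 (λ a b c d e f →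
        ((a :* d :+ c :* b) :* f :+ e :* (b :* d)) :* (b :* (d :* f)) :=
        (a :* (d :* f) :+ (c :* f :+ e :* d) :* b) :* (b :* d :* f)) refl a b c d e f

      +ᶠ-comm : ∀ p r → p +ᶠ r ~ r +ᶠ p
      +ᶠ-comm (fraction a b _) (fraction c d _) = solve 4 (λ a b c d →
        (a :* d :+ c :* b) :* (d :* b) := (c :* b :+ a :* d) :* (b :* d)) refl a b c d

      +ᶠ-identityˡ : ∀ p → embed 0# +ᶠ p ~ p
      +ᶠ-identityˡ (fraction a b _) = solve 2 (λ a b →
        (con 0 :* b :+ a :* con 1) :* b := a :* (con 1 :* b)) refl a b

      +ᶠ-inverseˡ : ∀ p → (-ᶠ p) +ᶠ p ~ embed 0#
      +ᶠ-inverseˡ (fraction a b _) = begin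
        (- a * b + a * b) * 1# ≈⟨ *-identityʳ _ ⟩
        - a * b + a * b        ≈⟨ sym (distribʳ b (- a) a) ⟩
        (- a + a) * b          ≈⟨ *-congʳ (-‿inverseˡ a) ⟩
        0# * b                 ≈⟨ zeroˡ b ⟩
        0#                     ≈⟨ sym (zeroˡ (b * b)) ⟩
        0# * (b * b)           ∎

      *ᶠ-assoc : ∀ p r s → (p *ᶠ r) *ᶠ s ~ p *ᶠ (r *ᶠ s)
      *ᶠ-assoc (fraction a b _) (fraction c d _) (fraction e f _) = solve 6 (λ a b c d e f →
        (a :* c :* e) :* (b :* (d :* f)) := (a :* (c :* e)) :* (b :* d :* f)) refl a b c d e f

      *ᶠ-comm : ∀ p r → p *ᶠ r ~ r *ᶠ p
      *ᶠ-comm (fraction a b _) (fraction c d _) = solve 4 (λ a b c d →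
        (a :* c) :* (d :* b) := (c :* a) :* (b :* d)) refl a b c d

      *ᶠ-identityˡ : ∀ p → embed 1# *ᶠ p ~ p
      *ᶠ-identityˡ (fraction a b _) = solve 2 (λ a b →
        (con 1 :* a) :* b := a :* (con 1 :* b)) refl a b

      distribˡᶠ : ∀ p r s → p *ᶠ (r +ᶠ s) ~ (p *ᶠ r) +ᶠ (p *ᶠ s)
      distribˡᶠ (fraction a b _) (fraction c d _) (fraction e f _) = solve 6 (λ a b c d e f →
        (a :* (c :* f :+ e :* d)) :* (b :* d :* (b :* f)) :=
        (a :* c :* (b :* f) :+ a :* e :* (b :* d)) :* (b :* (d :* f))) refl a b c d e f

      *ᶠ-inverse : ∀ p (num≉0 : ¬ num p ≈ 0#) → p *ᶠ fraction (den p) (num p) num≉0 ~ embed 1#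
      *ᶠ-inverse (fraction a b _) _ = solve 2 (λ a b → (a :* b) :* con 1 := con 1 :* (b :* a)) refl a b

      embed-+ : ∀ x y → embed (x + y) ~ embed x +ᶠ embed y
      embed-+ = solve 2 (λ x y → (x :+ y) :* (con 1 :* con 1) := (x :* con 1 :+ y :* con 1) :* con 1) refl

      embed-* : ∀ x y → embed (x * y) ~ embed x *ᶠ embed y
      embed-* x y = *-congˡ (*-identityˡ 1#)

      embed-neg : ∀ x → embed (- x) ~ -ᶠ embed x
      embed-neg x = refl

  fractionRing : CommutativeRing 0ℓ 0ℓ
  fractionRing = record
    { Carrier = Fraction
    ; _≈_ = _≈ᶠ_
    ; _+_ = _+ᶠ_
    ; _*_ = _*ᶠ_
    ; -_ = -ᶠ_
    ; 0# = embed 0#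
    ; 1# = embed 1#
    ; isCommutativeRing = record
      { isRing = record
        { +-isAbelianGroup = record
          { isGroup = record
            { isMonoid = record
              { isSemigroup = record
                { isMagma = record
                  { isEquivalence = record
                    { refl = cross refl
                    ; sym = λ p → cross (sym (uncross p))
                    ; trans = λ {p} {r} {s} → ≈ᶠ-trans {p} {r} {s}
                    }
                  ; ∙-cong = λ {p} {p′} {r} {r′} → ≈ᶠ-+-cong {p} {p′} {r} {r′}
                  }
                ; assoc = λ p r s → cross (+ᶠ-assoc p r s)
                }
              ; identity = (λ p → cross (+ᶠ-identityˡ p))
                         , (λ p → ≈ᶠ-trans {p +ᶠ embed 0#} {embed 0# +ᶠ p} (cross (+ᶠ-comm p (embed 0#))) (cross (+ᶠ-identityˡ p)))
              }
            ; inverse = (λ p → cross (+ᶠ-inverseˡ p))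
                      , (λ p → ≈ᶠ-trans {p +ᶠ (-ᶠ p)} {(-ᶠ p) +ᶠ p} (cross (+ᶠ-comm p (-ᶠ p))) (cross (+ᶠ-inverseˡ p)))
            ; ⁻¹-cong = λ {p} {r} p≈r → cross (-ᶠ-cong p r (uncross p≈r))
            }
          ; comm = λ p r → cross (+ᶠ-comm p r)
          }
        ; *-cong = λ {p} {p′} {r} {r′} p≈p′ r≈r′ → cross (*ᶠ-cong p p′ r r′ (uncross p≈p′) (uncross r≈r′))
        ; *-assoc = λ p r s → cross (*ᶠ-assoc p r s)
        ; *-identity = (λ p → cross (*ᶠ-identityˡ p))
                     , (λ p → ≈ᶠ-trans {p *ᶠ embed 1#} {embed 1# *ᶠ p} (cross (*ᶠ-comm p (embed 1#))) (cross (*ᶠ-identityˡ p)))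
        ; distrib = (λ p r s → cross (distribˡᶠ p r s))
                  , (λ p r s → ≈ᶠ-trans {(r +ᶠ s) *ᶠ p} {p *ᶠ (r +ᶠ s)} (cross (*ᶠ-comm (r +ᶠ s) p))
                      (≈ᶠ-trans {p *ᶠ (r +ᶠ s)} {(p *ᶠ r) +ᶠ (p *ᶠ s)} (cross (distribˡᶠ p r s))
                        (≈ᶠ-+-cong {p *ᶠ r} {r *ᶠ p} {p *ᶠ s} {s *ᶠ p}
                          (cross (*ᶠ-comm p r)) (cross (*ᶠ-comm p s)))))
        }
      ; *-comm = λ p r → cross (*ᶠ-comm p r)
      }
    }
    where
    ≈ᶠ-trans : ∀ {p r s} → p ≈ᶠ r → r ≈ᶠ s → p ≈ᶠ s
    ≈ᶠ-trans {p} {r} {s} p≈r r≈s = cross (~-trans p r s (uncross p≈r) (uncross r≈s))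

    ≈ᶠ-+-cong : ∀ {p p′ r r′} → p ≈ᶠ p′ → r ≈ᶠ r′ → p +ᶠ r ≈ᶠ p′ +ᶠ r′
    ≈ᶠ-+-cong {p} {p′} {r} {r′} p≈p′ r≈r′ = cross (+ᶠ-cong p p′ r r′ (uncross p≈p′) (uncross r≈r′))

  private
    ≈0⇒num≈0 : ∀ p → p ≈ᶠ embed 0# → num p ≈ 0#
    ≈0⇒num≈0 p p≈0 = trans (sym (*-identityʳ _)) (trans (uncross p≈0) (zeroˡ _))

    num≈0⇒≈0 : ∀ p → num p ≈ 0# → p ≈ᶠ embed 0#
    num≈0⇒≈0 p num≈0 = cross (trans (*-identityʳ _) (trans num≈0 (sym (zeroˡ _))))

  fractionField : Field
  fractionField = record
    { commutativeRing = fractionRing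
    ; _≟_ = λ p r → map′ cross uncross ((num p * den r) ≟ (num r * den p))
    ; 1≉0 = λ 1≈0 → 1≉0 (≈0⇒num≈0 (embed 1#) 1≈0)
    ; inverse = λ {p} p≉0 → Division.unit fractionRing
        (fraction (den p) (num p) (λ num≈0 → p≉0 (num≈0⇒≈0 p num≈0)))
        (cross (*ᶠ-inverse p (λ num≈0 → p≉0 (num≈0⇒≈0 p num≈0))))
    }

  embed-hom : IsHom commutativeRing fractionRing embed
  embed-hom = record
    { isSemiringHomomorphism = record
      { isNearSemiringHomomorphism = record
        { +-isMonoidHomomorphism = record
          { isMagmaHomomorphism = record
            { isRelHomomorphism = record { cong = λ p → cross (*-congʳ p) }
            ; homo = λ x y → cross (embed-+ x y)
            }
          ; ε-homo = cross refl
          }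
        ; *-homo = λ x y → cross (embed-* x y)
        }
      ; 1#-homo = cross refl
      }
    ; -‿homo = λ x → cross (embed-neg x)
    }

  embed-unit : ∀ {x} → ¬ x ≈ 0# → Division.Unit fractionRing (embed x)
  embed-unit {x} x≉0 = Field.inverse fractionField {embed x} (λ x≈0 → x≉0 (≈0⇒num≈0 (embed x) x≈0))

module QNumbers (R : CommutativeRing 0ℓ 0ℓ) where
  open CommutativeRing R
  open Algebra.Properties.Semiring.Exp semiring using (_^_)
  open Division R

  qInt : Carrier → ℕ → Carrier
  qInt q zero    = 0#
  qInt q (suc n) = qInt q n + q ^ n

  qFactorial : Carrier → ℕ → Carrier
  qFactorial q zero    = 1#
  qFactorial q (suc n) = qFactorial q n * qInt q (suc n)

  qFactorial-unit : ∀ {q} → (∀ n → Unit (qInt q (suc n))) → ∀ n → Unit (qFactorial q n)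
  qFactorial-unit u zero    = unit-1
  qFactorial-unit u (suc n) = unit-* (qFactorial-unit u n) (u n)

  -- P n q t is P_n^(inv,udr)(q,t).
  P : ℕ → Carrier → Carrier → Carrier
  P n q t = foldr _+_ 0# (map (λ π → q ^ inv π * t ^ udr π) (permutations n))

module QExponentials (R : CommutativeRing 0ℓ 0ℓ) (q : CommutativeRing.Carrier R)
  (qFactorial-unit : ∀ n → Division.Unit R (QNumbers.qFactorial R q n)) where
  open CommutativeRing R
  open Algebra.Properties.Semiring.Exp semiring using (_^_)
  open Division R
  open PowerSeries R using (Series)
  open QNumbers R using (qFactorial)

  exp-q Exp-q : Series
  exp-q n = 1# / qFactorial q n [ qFactorial-unit n ]
  Exp-q n = q ^ (n C 2) / qFactorial q n [ qFactorial-unit n ]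

module HomProperties (R S : CommutativeRing 0ℓ 0ℓ)
  (f : CommutativeRing.Carrier R → CommutativeRing.Carrier S) (f-hom : IsHom R S f) where
  private
    module R = CommutativeRing R
    module S = CommutativeRing S
    open Algebra.Properties.Semiring.Exp R.semiring using () renaming (_^_ to _^ᴿ_)
    open Algebra.Properties.Semiring.Exp S.semiring using () renaming (_^_ to _^ˢ_)
    open QNumbers R using () renaming (qInt to qIntᴿ)
    open QNumbers S using () renaming (qInt to qIntˢ)
  open RingMorphisms.IsRingHomomorphism f-hom

  hom-^ : ∀ x n → f (x ^ᴿ n) S.≈ f x ^ˢ n
  hom-^ x zero    = 1#-homo
  hom-^ x (suc n) = S.trans (*-homo x (x ^ᴿ n)) (S.*-congˡ (hom-^ x n))

  hom-qInt : ∀ q n → f (qIntᴿ q n) S.≈ qIntˢ (f q) n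
  hom-qInt q zero    = 0#-homo
  hom-qInt q (suc n) = S.trans (+-homo (qIntᴿ q n) (q ^ᴿ n)) (S.+-cong (hom-qInt q n) (hom-^ q n))

  hom-2 : f (R.1# R.+ R.1#) S.≈ S.1# S.+ S.1#
  hom-2 = S.trans (+-homo R.1# R.1#) (S.+-cong 1#-homo 1#-homo)

  hom-1+ : ∀ x → f (R.1# R.+ x) S.≈ S.1# S.+ f x
  hom-1+ x = S.trans (+-homo R.1# x) (S.+-congʳ 1#-homo)

  hom-1- : ∀ x → f (R.1# R.- x) S.≈ S.1# S.- f x
  hom-1- x = S.trans (hom-1+ (R.- x)) (S.+-congˡ (-‿homo x))

module RationalFunctions (K : Field) where
  open Polynomials (Field.integralDomain K) public
  open Fractions polynomialDomain public

  private
    module K = Field K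
    module P = IntegralDomain polynomialDomain
    module F = CommutativeRing fractionRing
    open PowerSeries K.commutativeRing using (X; *ₛ-zero; Series; _*ₛ_)
    open Algebra.Properties.Semiring.Exp P.semiring using () renaming (_^_ to _^ₚ_)
    open Algebra.Properties.Semiring.Exp F.semiring using (_^_)
    open QNumbers polynomialRing using () renaming (qInt to qIntₚ)
    open QNumbers fractionRing using (qInt)
    open Division fractionRing using (Unit; unit-resp)
    open HomProperties polynomialRing fractionRing embed embed-hom using (hom-^; hom-qInt; hom-1+; hom-1-)
    open RingMorphisms.IsRingHomomorphism embed-hom using (+-homo)

  indeterminate : Fraction
  indeterminate = embed Xₚ

  scalar : K.Carrier → Fraction
  scalar a = embed (constₚ a)

  scalar-hom : IsHom K.commutativeRing fractionRing scalar
  scalar-hom = Composition.isRingHomomorphism F.trans constₚ-hom embed-hom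

  private
    X*-coeff₀ : ∀ (f : Series) → (X *ₛ f) 0 K.≈ K.0#
    X*-coeff₀ f = K.trans (*ₛ-zero X f) (K.zeroˡ (f 0))

    1-unit : ∀ {p} → coeff p 0 K.≈ K.1# → Unit (embed p)
    1-unit p₀≈1 = embed-unit λ p≈0 → K.1≉0 (K.trans (K.sym p₀≈1) (at p≈0 0))

    qInt-coeff₀ : ∀ n → coeff (qIntₚ Xₚ (suc n)) 0 K.≈ K.1#
    qInt-coeff₀ zero    = K.+-identityˡ K.1#
    qInt-coeff₀ (suc n) = K.trans
      (K.+-cong (qInt-coeff₀ n) (X*-coeff₀ (coeff (Xₚ ^ₚ n)))) (K.+-identityʳ K.1#)

    -0≈0 : K.- K.0# K.≈ K.0#
    -0≈0 = K.trans (K.sym (K.+-identityˡ _)) (K.-‿inverseʳ K.0#)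

  qInt-unit : ∀ n → Unit (qInt indeterminate (suc n))
  qInt-unit n = unit-resp (hom-qInt Xₚ (suc n)) (1-unit (qInt-coeff₀ n))

  1+x²-unit : Unit (F.1# F.+ indeterminate ^ 2)
  1+x²-unit = unit-resp (F.trans (hom-1+ (Xₚ ^ₚ 2)) (F.+-congˡ (hom-^ Xₚ 2)))
    (1-unit (K.trans (K.+-congˡ (X*-coeff₀ (coeff (Xₚ ^ₚ 1)))) (K.+-identityʳ K.1#)))

  1-x²-unit : Unit (F.1# F.- indeterminate ^ 2)
  1-x²-unit = unit-resp (F.trans (hom-1- (Xₚ ^ₚ 2)) (F.+-congˡ (F.-‿cong (hom-^ Xₚ 2))))
    (1-unit (K.trans (K.+-congˡ (K.trans (K.-‿cong (X*-coeff₀ (coeff (Xₚ ^ₚ 1)))) -0≈0)) (K.+-identityʳ K.1#)))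

-- ℚ(q,t) is constructed as ℚ(q)(t).
ℚ⟨q⟩ ℚ⟨q,t⟩ : Field
ℚ⟨q⟩   = RationalFunctions.fractionField rationalField
ℚ⟨q,t⟩ = RationalFunctions.fractionField ℚ⟨q⟩

private
  module ℚ⟨q⟩ = Field ℚ⟨q⟩
  module ℚ⟨q⟩ᶠ = RationalFunctions rationalField
  module ℚ⟨q,t⟩ᶠ = RationalFunctions ℚ⟨q⟩

  ℚ-2-unit : Division.Unit ℚₚ.+-*-commutativeRing (ℚ.1ℚ ℚ.+ ℚ.1ℚ)
  ℚ-2-unit = Field.inverse rationalField λ ()

  ℚ⟨q⟩-2-unit : ℚ⟨q⟩.Unit (ℚ⟨q⟩.1# ℚ⟨q⟩.+ ℚ⟨q⟩.1#)
  ℚ⟨q⟩-2-unit = ℚ⟨q⟩.unit-resp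
    (HomProperties.hom-2 ℚₚ.+-*-commutativeRing ℚ⟨q⟩.commutativeRing ℚ⟨q⟩ᶠ.scalar ℚ⟨q⟩ᶠ.scalar-hom)
    (hom-unit ℚₚ.+-*-commutativeRing ℚ⟨q⟩.commutativeRing ℚ⟨q⟩ᶠ.scalar-hom ℚ-2-unit)

-- R is one of the coefficient rings ℚ(q,t) and ℚ(q)⟦t⟧, and ι is the
-- inclusion of ℚ(q).
module Coefficients (R : CommutativeRing 0ℓ 0ℓ) (ι : ℚ⟨q⟩.Carrier → CommutativeRing.Carrier R)
  (ι-hom : IsHom ℚ⟨q⟩.commutativeRing R ι) where

  open CommutativeRing R public
  open Algebra.Properties.Semiring.Exp semiring public using (_^_)
  open Division R public
  open PowerSeries R public
  open QNumbers R public using (qInt; qFactorial; P)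

  q 2# : Carrier
  q  = ι ℚ⟨q⟩ᶠ.indeterminate
  2# = 1# + 1#

  qFactorial-unit : ∀ n → Unit (qFactorial q n)
  qFactorial-unit = QNumbers.qFactorial-unit R λ n →
    unit-resp (HomProperties.hom-qInt ℚ⟨q⟩.commutativeRing R ι ι-hom ℚ⟨q⟩ᶠ.indeterminate (suc n)) (hom-unit ℚ⟨q⟩.commutativeRing R ι-hom (ℚ⟨q⟩ᶠ.qInt-unit n))

  2-unit : Unit 2#
  2-unit = unit-resp (HomProperties.hom-2 ℚ⟨q⟩.commutativeRing R ι ι-hom) (hom-unit ℚ⟨q⟩.commutativeRing R ι-hom ℚ⟨q⟩-2-unit)

  open QExponentials R q qFactorial-unit public

  open CommutativeRing seriesRing public using () renaming (_-_ to _-ₛ_)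
  open Division seriesRing public using () renaming (Unit to Unitₛ; _/_[_] to _/ₛ_[_])

  denominator-unit : ∀ a (e E : Series) → e 0 ≈ 1# → E 0 ≈ 1# → Unit (1# - a) →
                     Unitₛ (1ₛ -ₛ const a *ₛ e *ₛ E)
  denominator-unit a e E e₀≈1 E₀≈1 u = unit-series (unit-resp (+-congˡ (-‿cong (sym (begin
    (const a *ₛ e *ₛ E) 0   ≈⟨ *ₛ-zero (const a *ₛ e) E ⟩
    (const a *ₛ e) 0 * E 0  ≈⟨ *-cong (*ₛ-zero (const a) e) E₀≈1 ⟩
    a * e 0 * 1#            ≈⟨ *-identityʳ _ ⟩
    a * e 0                 ≈⟨ *-congˡ e₀≈1 ⟩
    a * 1#                  ≈⟨ *-identityʳ a ⟩
    a                       ∎)))) u)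
    where open SetoidReasoning setoid

  exp-q-0 : exp-q 0 ≈ 1#
  exp-q-0 = *-identityˡ 1#

  Exp-q-0 : Exp-q 0 ≈ 1#
  Exp-q-0 = *-identityˡ 1#

  rescale-0 : ∀ a (f : Series) → f 0 ≈ 1# → rescale a f 0 ≈ 1#
  rescale-0 a f f₀≈1 = trans (*-identityˡ _) f₀≈1

module OverRationalFunctions where
  open Coefficients ℚ⟨q,t⟩ᶠ.fractionRing ℚ⟨q,t⟩ᶠ.scalar ℚ⟨q,t⟩ᶠ.scalar-hom public

  t : Carrier
  t = ℚ⟨q,t⟩ᶠ.indeterminate

  1+t²-unit : Unit (1# + t ^ 2)
  1+t²-unit = ℚ⟨q,t⟩ᶠ.1+x²-unit

  1-t²-unit : Unit (1# - t ^ 2)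
  1-t²-unit = ℚ⟨q,t⟩ᶠ.1-x²-unit

  1-t²eE-unit : Unitₛ (1ₛ -ₛ const (t ^ 2) *ₛ exp-q *ₛ Exp-q)
  1-t²eE-unit = denominator-unit (t ^ 2) exp-q Exp-q exp-q-0 Exp-q-0 1-t²-unit

module OverPowerSeries where
  private
    module T = PowerSeries ℚ⟨q⟩.commutativeRing
    module K = ℚ⟨q⟩
  open Coefficients T.seriesRing T.const T.const-hom public

  t : Carrier
  t = T.X

  private
    ½ : K.Carrier
    ½ = proj₁ ℚ⟨q⟩-2-unit

    ½+½≈1 : ½ K.+ ½ K.≈ K.1#
    ½+½≈1 = begin
      ½ K.+ ½                   ≈⟨ K.+-cong (K.sym (K.*-identityˡ ½)) (K.sym (K.*-identityˡ ½)) ⟩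
      K.1# K.* ½ K.+ K.1# K.* ½ ≈⟨ K.sym (K.distribʳ ½ K.1# K.1#) ⟩
      (K.1# K.+ K.1#) K.* ½     ≈⟨ proj₂ (proj₂ ℚ⟨q⟩-2-unit) ⟩
      K.1#                      ∎
      where open SetoidReasoning K.setoid

    -0≈0 : K.- K.0# K.≈ K.0#
    -0≈0 = K.trans (K.sym (K.+-identityˡ _)) (K.-‿inverseʳ K.0#)

    plus-0 : ∀ {a b} → b K.≈ K.0# → a K.+ b K.≈ a
    plus-0 b≈0 = K.trans (K.+-congˡ b≈0) (K.+-identityʳ _)

    minus-0 : ∀ {a b} → b K.≈ K.0# → a K.- b K.≈ a
    minus-0 b≈0 = plus-0 (K.trans (K.-‿cong b≈0) -0≈0)

    *ₛ-coeff₀ : ∀ (f g : Carrier) → f 0 K.≈ K.0# → (f * g) 0 K.≈ K.0#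
    *ₛ-coeff₀ f g f₀≈0 = K.trans (T.*ₛ-zero f g) (K.trans (K.*-congʳ f₀≈0) (K.zeroˡ _))

    t²-coeff₁ : (t ^ 2) 1 K.≈ K.0#
    t²-coeff₁ = K.trans (T.X*ₛ-suc (t ^ 1) 0) (*ₛ-coeff₀ t 1# K.refl)

  open T.SquareRoot ½ ½+½≈1 using (√; √-square)

  √[1-t²] : Carrier
  √[1-t²] = √ (1# - t ^ 2)

  √[1-t²]-square : √[1-t²] * √[1-t²] ≈ 1# - t ^ 2
  √[1-t²]-square = T.coefficientwise (√-square (minus-0 (*ₛ-coeff₀ t (t ^ 1) K.refl)))

  √[1-t²]-0 : √[1-t²] 0 K.≈ K.1#
  √[1-t²]-0 = K.refl

  -- (1 - √(1-t²)) / t; the numerator has constant term 0.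
  v : Carrier
  v = T.tail (1# - √[1-t²])

  t*v : t * v ≈ 1# - √[1-t²]
  t*v = T.coefficientwise (T.X*ₛ-tail (1# - √[1-t²]) (K.-‿inverseʳ K.1#))

  v-0 : v 0 K.≈ K.0#
  v-0 = K.trans (minus-0 (K.trans (K.*-congˡ (minus-0 t²-coeff₁)) (K.zeroʳ ½))) K.refl

  private
    unitˢ : ∀ {f : Carrier} → f 0 K.≈ K.1# → Unit f
    unitˢ f₀≈1 = T.unit-series (K.unit-resp (K.sym f₀≈1) K.unit-1)

    v²-0 : (v ^ 2) 0 K.≈ K.0#
    v²-0 = *ₛ-coeff₀ v (v ^ 1) v-0

  1+v-unit : Unit (1# + v)
  1+v-unit = unitˢ (plus-0 v-0)

  1+v²-unit : Unit (1# + v ^ 2)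
  1+v²-unit = unitˢ (plus-0 v²-0)

  w : Carrier
  w = (1# - v ^ 2) / (1# + v ^ 2) [ 1+v²-unit ]

  1-v²-unit : Unit (1# - v ^ 2)
  1-v²-unit = unitˢ (minus-0 v²-0)

  private
    e-0 : rescale w exp-q 0 ≈ 1#
    e-0 = rescale-0 w exp-q exp-q-0

    E-0 : rescale w Exp-q 0 ≈ 1#
    E-0 = rescale-0 w Exp-q Exp-q-0

  1-v²eE-unit : Unitₛ (1ₛ -ₛ const (v ^ 2) *ₛ rescale w exp-q *ₛ rescale w Exp-q)
  1-v²eE-unit = denominator-unit (v ^ 2) (rescale w exp-q) (rescale w Exp-q) e-0 E-0 1-v²-unit

module Submission where

-- Deleting the first letter j of a permutation lowers inv by j, and udr changes according to whether
-- the first step continues the direction of the next one.  Recording the direction gives a recurrence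
-- with a 2 × 2 transfer matrix for ascents and one for descents.  With s = 2v/(1+v²) the difference of
-- the two matrices has eigenvalues ±w, w = (1-v²)/(1+v²).  Along its eigenvectors the recurrence for the
-- generating functions refined by the first letter becomes scalar, and the q-binomial theorem solves it:
-- with a = s(1-v), p = a + w ∑ P_n x^n/(w^n [n]_q!) and r the analogue of p with the two directions
-- exchanged,
--   p = exp_q(x) (v r + a(1-v)),   r = Exp_q(x) (v p + a(1-v)).
-- Eliminating r gives the first identity, and substituting w x for x gives the second.

open import Defs
open import Algebra.Bundles using (CommutativeRing)
import Algebra.Properties.CommutativeMonoid.Sum
import Algebra.Properties.CommutativeSemiring.Exp
import Algebra.Properties.Ring
import Algebra.Properties.Semiring.Exp
import Algebra.Properties.Semiring.Sum
import Algebra.Solver.Ring.NaturalCoefficients.Default as Solver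
open import Data.Bool using (Bool; true; false; not; if_then_else_)
open import Data.Bool.Properties using (not-¬)
open import Data.Empty using (⊥-elim)
open import Data.Fin as Fin using (Fin; zero; suc; toℕ; punchIn)
open import Data.Fin.Permutation as Perm using (Permutation′; _⟨$⟩ʳ_; insert)
import Data.Fin.Properties as Finₚ
open import Data.List using (List; []; _∷_; _++_; length; filter; map; foldr; tabulate; allFin; cartesianProduct; cartesianProductWith)
import Data.List.Properties as Listₚ
open import Data.Nat as ℕ using (ℕ; zero; suc; z≤n; s≤s; _∸_)
import Data.Nat.Properties as ℕₚ
open import Data.Nat.Combinatorics using (_C_; nC1≡n; nCk+nC[k+1]≡[n+1]C[k+1])
open import Data.Product using (∃; _×_; _,_; proj₁; proj₂)
open import Data.Sum as ⊎ using (inj₁; inj₂)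
open import Function using (_∘_; _⇔_; mk⇔; Equivalence)
open import Level using (0ℓ)
open import Relation.Binary using (Decidable)
import Relation.Binary.Reasoning.Setoid as SetoidReasoning
open import Relation.Binary.PropositionalEquality as ≡ using (_≡_; _≢_)
open import Relation.Nullary using (¬_; Dec; yes; no; does)
open import Relation.Nullary.Decidable using (does-⇔; dec-true; dec-false; _×-dec_; _⊎-dec_)

-- Prefixing `j` to a permutation with first letter `k` gives an ascent if `j ≤ k` and a descent if
-- `k < j`, so the two transfer matrices are summed over complementary ranges of `k`. Writing one
-- range as everything minus the other leaves a part independent of `j`, plus the difference of the
-- matrices summed over a single range. For the eigenvalue `-w` the range `k < j` is used in place
-- of `j ≤ k`, so both scalar recurrences carry the same factor `w`. They differ only in the end
-- from which the range grows, and this is what separates `exp_q` from `Exp_q`. The part independent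
-- of `j` involves the opposite direction and couples the two equations. The eigenvalues are
-- `±√(1 - s²)`. The parameter `v` makes this root rational, whence the argument `2t/(1+t²)` in the
-- first identity. The computation runs over any commutative ring in which `v`, `s`, `w` satisfy
-- their relations: `v = t` over ℚ(q,t) gives the first identity, and `s = t` over ℚ(q)⟦t⟧ the
-- second.

module UpDownRuns where

  private
    module ℕΣ = Algebra.Properties.CommutativeMonoid.Sum ℕₚ.+-0-commutativeMonoid
  open ℕΣ using (sum)
  open ≡ using (refl; sym; trans; cong; cong₂)

  -- Counting positions and pairs of positions

  indicator : Bool → ℕ
  indicator b = if b then 1 else 0

  indicator-⊎ : ∀ {P Q : Set} (P? : Dec P) (Q? : Dec Q) → ¬ (P × Q) →
                indicator (does (P? ⊎-dec Q?)) ≡ indicator (does P?) ℕ.+ indicator (does Q?)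
  indicator-⊎ (yes p) (yes q) ¬pq = ⊥-elim (¬pq (p , q))
  indicator-⊎ (yes _) (no _)  ¬pq = refl
  indicator-⊎ (no _)  (yes _) ¬pq = refl
  indicator-⊎ (no _)  (no _)  ¬pq = refl

  count : ∀ {n} {P : Fin n → Set} → (∀ i → Dec (P i)) → ℕ
  count P? = sum λ i → indicator (does (P? i))

  count-cong : ∀ {n} {P Q : Fin n → Set} (P? : ∀ i → Dec (P i)) (Q? : ∀ i → Dec (Q i)) →
               (∀ i → P i ⇔ Q i) → count P? ≡ count Q?
  count-cong P? Q? P⇔Q = ℕΣ.sum-cong-≗ λ i → cong indicator (does-⇔ (P⇔Q i) (P? i) (Q? i))

  count-none : ∀ {n} {P : Fin n → Set} (P? : ∀ i → Dec (P i)) → (∀ i → ¬ P i) → count P? ≡ 0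
  count-none {n} P? ¬P = trans (ℕΣ.sum-cong-≗ λ i → cong indicator (dec-false (P? i) (¬P i)))
    (ℕΣ.sum-replicate-zero n)

  count-≡0 : ∀ {n} {P : Fin (suc n) → Set} (P? : ∀ i → Dec (P i)) → (∀ i → P i ⇔ i ≡ zero) → count P? ≡ 1
  count-≡0 P? P⇔ = cong₂ ℕ._+_
    (cong indicator (dec-true (P? zero) (Equivalence.from (P⇔ zero) refl)))
    (count-none (λ i → P? (suc i)) λ i p → Finₚ.0≢1+n (sym (Equivalence.to (P⇔ (suc i)) p)))

  count-< : ∀ {n} j → j ℕ.≤ n → count {n} (λ i → toℕ i ℕ.<? j) ≡ j
  count-< {n} zero    j≤n = count-none {n} (λ i → toℕ i ℕ.<? 0) λ i ()
  count-< {suc n} (suc j) (s≤s j≤n) = cong suc (trans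
    (count-cong {n} (λ i → suc (toℕ i) ℕ.<? suc j) (λ i → toℕ i ℕ.<? j) λ i → mk⇔ ℕₚ.≤-pred s≤s)
    (count-< j j≤n))

  length-filter-tabulate : ∀ {A : Set} {P : A → Set} (P? : ∀ x → Dec (P x)) {n} (f : Fin n → A) →
                           length (filter P? (tabulate f)) ≡ count (λ i → P? (f i))
  length-filter-tabulate P? {zero}  f = refl
  length-filter-tabulate P? {suc n} f with does (P? (f zero))
  ... | true  = cong suc (length-filter-tabulate P? (f ∘ suc))
  ... | false = length-filter-tabulate P? (f ∘ suc)

  length-filter-map : ∀ {A B : Set} {P : B → Set} (P? : ∀ x → Dec (P x)) (f : A → B) xs →
                      length (filter P? (map f xs)) ≡ length (filter (λ x → P? (f x)) xs)
  length-filter-map P? f []       = refl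
  length-filter-map P? f (x ∷ xs) with does (P? (f x))
  ... | true  = cong suc (length-filter-map P? f xs)
  ... | false = length-filter-map P? f xs

  length-filter-product : ∀ {A B : Set} {P : A × B → Set} (P? : ∀ x → Dec (P x)) {n} (f : Fin n → A) ys →
                          length (filter P? (cartesianProduct (tabulate f) ys)) ≡
                          sum λ i → length (filter (λ y → P? (f i , y)) ys)
  length-filter-product P? {zero}  f ys = refl
  length-filter-product P? {suc n} f ys = begin
    length (filter P? (map (f zero ,_) ys ++ rest))
      ≡⟨ cong length (Listₚ.filter-++ P? (map (f zero ,_) ys) rest) ⟩
    length (filter P? (map (f zero ,_) ys) ++ filter P? rest)
      ≡⟨ Listₚ.length-++ (filter P? (map (f zero ,_) ys)) ⟩
    length (filter P? (map (f zero ,_) ys)) ℕ.+ length (filter P? rest)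
      ≡⟨ cong₂ ℕ._+_ (length-filter-map P? (f zero ,_) ys) (length-filter-product P? (f ∘ suc) ys) ⟩
    (sum λ i → length (filter (λ y → P? (f i , y)) ys)) ∎
    where
    open ≡.≡-Reasoning
    rest = cartesianProduct (tabulate (f ∘ suc)) ys

  countPairs-sum : ∀ {n} {P : Fin n → Fin n → Set} (P? : Decidable P) →
                   countPairs P? ≡ sum λ i → count (P? i)
  countPairs-sum {n} P? = trans
    (length-filter-product (λ ij → P? (proj₁ ij) (proj₂ ij)) (λ i → i) (allFin n))
    (ℕΣ.sum-cong-≗ λ i → length-filter-tabulate (P? i) (λ j → j))

  count-shift : ∀ {n} {P : Fin (suc n) → Set} {Q : Fin n → Set} (P? : ∀ i → Dec (P i)) (Q? : ∀ i → Dec (Q i)) →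
                ¬ P zero → (∀ i → P (suc i) ⇔ Q i) → count P? ≡ count Q?
  count-shift P? Q? ¬P₀ P⇔Q = cong₂ ℕ._+_ (cong indicator (dec-false (P? zero) ¬P₀))
    (count-cong (λ i → P? (suc i)) Q? P⇔Q)

  -- Opaque, so that decision procedures are not unfolded when counts are compared.
  opaque
    pairs : ∀ {n} {P : Fin n → Fin n → Set} → Decidable P → ℕ
    pairs P? = sum λ i → count (P? i)

    pairs-sum : ∀ {n} {P : Fin n → Fin n → Set} (P? : Decidable P) → pairs P? ≡ sum λ i → count (P? i)
    pairs-sum P? = refl

    -- The pattern of a new birun at the front: every old pair moves by one in both coordinates, and
    -- the single pair (0, 1) is added.
    pairs-turn : ∀ {n} {P : Fin (suc (suc n)) → Fin (suc (suc n)) → Set} {Q : Fin (suc n) → Fin (suc n) → Set}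
                 (P? : Decidable P) (Q? : Decidable Q) → (∀ i → ¬ P i zero) →
                 (∀ k → P zero (suc k) ⇔ k ≡ zero) → (∀ i k → P (suc i) (suc k) ⇔ Q i k) →
                 pairs P? ≡ suc (pairs Q?)
    pairs-turn P? Q? ¬P₀ row₀ rows = cong₂ ℕ._+_
      (cong₂ ℕ._+_ (cong indicator (dec-false (P? zero zero) (¬P₀ zero))) (count-≡0 (λ k → P? zero (suc k)) row₀))
      (ℕΣ.sum-cong-≗ λ i → count-shift (P? (suc i)) (Q? i) (¬P₀ (suc i)) (rows i))

    -- The pattern of a front birun that absorbs the new letter: its start stays at 0 while its end
    -- moves, so row 1 becomes empty and nothing is gained.
    pairs-straight : ∀ {n} {P : Fin (suc (suc n)) → Fin (suc (suc n)) → Set} {Q : Fin (suc n) → Fin (suc n) → Set}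
                     (P? : Decidable P) (Q? : Decidable Q) → (∀ i → ¬ P i zero) →
                     (∀ k → P zero (suc k) ⇔ Q zero k) → (∀ k → ¬ P (suc zero) (suc k)) →
                     (∀ i k → P (suc (suc i)) (suc k) ⇔ Q (suc i) k) →
                     pairs P? ≡ pairs Q?
    pairs-straight P? Q? ¬P₀ row₀ row₁ rows = cong₂ ℕ._+_
      (count-shift (P? zero) (Q? zero) (¬P₀ zero) row₀)
      (cong₂ ℕ._+_ (count-none (P? (suc zero)) λ { zero → ¬P₀ (suc zero) ; (suc k) → row₁ k })
        (ℕΣ.sum-cong-≗ λ i → count-shift (P? (suc (suc i))) (Q? (suc i)) (¬P₀ (suc (suc i))) (rows i)))

  -- Inversions after prefixing a letter

  punchIn-< : ∀ {n} (i : Fin (suc n)) (j k : Fin n) → j Fin.< k ⇔ punchIn i j Fin.< punchIn i k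
  punchIn-< i j k = mk⇔
    (λ j<k → ℕₚ.≰⇒> λ k≤j → ℕₚ.<⇒≱ j<k (Finₚ.punchIn-cancel-≤ i k j k≤j))
    (λ j<k → ℕₚ.≰⇒> λ k≤j → ℕₚ.<⇒≱ j<k (Finₚ.punchIn-mono-≤ i k j k≤j))

  punchIn<i : ∀ {n} (i : Fin (suc n)) (j : Fin n) → punchIn i j Fin.< i ⇔ j Fin.< i
  punchIn<i zero    j       = mk⇔ (λ ()) (λ ())
  punchIn<i (suc i) zero    = mk⇔ (λ _ → s≤s z≤n) (λ _ → s≤s z≤n)
  punchIn<i (suc i) (suc j) = mk⇔
    (λ { (s≤s p) → s≤s (Equivalence.to (punchIn<i i j) p) })
    (λ { (s≤s p) → s≤s (Equivalence.from (punchIn<i i j) p) })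

  inv-insert : ∀ {n} j (σ : Permutation′ n) → inv (insert zero j σ) ≡ toℕ j ℕ.+ inv σ
  inv-insert {n} j σ = begin
    inv π ≡⟨ countPairs-sum (inversion? π) ⟩
    (sum λ i → count (inversion? π i))
      ≡⟨ cong₂ ℕ._+_ first rest ⟩
    toℕ j ℕ.+ (sum λ i → count (inversion? σ i))
      ≡⟨ cong (toℕ j ℕ.+_) (sym (countPairs-sum (inversion? σ))) ⟩
    toℕ j ℕ.+ inv σ ∎
    where
    open ≡.≡-Reasoning
    π = insert zero j σ

    first : count (inversion? π zero) ≡ toℕ j
    first = begin
      count (λ k → inversion? π zero (suc k))
        ≡⟨ count-cong (λ k → inversion? π zero (suc k)) (λ k → toℕ (σ ⟨$⟩ʳ k) ℕ.<? toℕ j)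
             (λ k → mk⇔ (λ p → Equivalence.to (punchIn<i j _) (proj₂ p))
                        (λ p → s≤s z≤n , Equivalence.from (punchIn<i j _) p)) ⟩
      count (λ k → toℕ (σ ⟨$⟩ʳ k) ℕ.<? toℕ j)
        -- `σ` permutes the letters, so positions whose letter is below `j` may be counted as
        -- letters below `j`.
        ≡⟨ sym (ℕΣ.sum-permute (λ k → indicator (does (toℕ k ℕ.<? toℕ j))) σ) ⟩
      count (λ (k : Fin n) → toℕ k ℕ.<? toℕ j)
        ≡⟨ count-< (toℕ j) (Finₚ.toℕ≤pred[n] j) ⟩
      toℕ j ∎

    rest : (sum λ i → count (inversion? π (suc i))) ≡ sum λ i → count (inversion? σ i)
    rest = ℕΣ.sum-cong-≗ λ i → count-cong (λ k → inversion? π (suc i) (suc k)) (inversion? σ i) λ k → mk⇔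
      (λ { (s≤s i<k , p) → i<k , Equivalence.from (punchIn-< j _ _) p })
      (λ { (i<k , p) → s≤s i<k , Equivalence.to (punchIn-< j _ _) p })

  -- The direction of a step of a permutation is true for an ascent.
  Lt : ∀ {n} → Bool → Fin n → Fin n → Set
  Lt true  x y = x Fin.< y
  Lt false x y = y Fin.< x

  Lt-trans : ∀ {n} d {x y z : Fin n} → Lt d x y → Lt d y z → Lt d x z
  Lt-trans true  p q = ℕₚ.<-trans p q
  Lt-trans false p q = ℕₚ.<-trans q p

  Lt-unique : ∀ {n} d e {x y : Fin n} → Lt d x y → Lt e x y → d ≡ e
  Lt-unique true  true  _ _ = refl
  Lt-unique true  false p q = ⊥-elim (ℕₚ.<-asym p q)
  Lt-unique false true  p q = ⊥-elim (ℕₚ.<-asym p q)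
  Lt-unique false false _ _ = refl

  -- Monotone segments, biruns and run counts for both directions

  module _ {n : ℕ} (π : Permutation′ n) where

    Mono : Bool → Fin n → Fin n → Set
    Mono d i j = ∀ k l → i Fin.≤ k → k Fin.< l → l Fin.≤ j → Lt d (π ⟨$⟩ʳ k) (π ⟨$⟩ʳ l)

    mono? : ∀ d → Decidable (Mono d)
    mono? true  = increasing? π
    mono? false = decreasing? π

    monotone? : Decidable (Monotone π)
    monotone? i j = increasing? π i j ⊎-dec decreasing? π i j

    birun? : Decidable (Birun π)
    birun? i j = (i Fin.<? j) ×-dec maximal? π monotone? i j

    biruns : ℕ
    biruns = pairs birun?

    toMonotone : ∀ d {i j} → Mono d i j → Monotone π i j
    toMonotone true  = inj₁
    toMonotone false = inj₂

    fromMonotone : ∀ {A : Set} {i j} → (∀ d → Mono d i j → A) → Monotone π i j → A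
    fromMonotone f (inj₁ p) = f true p
    fromMonotone f (inj₂ p) = f false p

    mono-refl : ∀ d i → Mono d i i
    mono-refl d i k l i≤k k<l l≤i = ⊥-elim (ℕₚ.<⇒≱ k<l (ℕₚ.≤-trans l≤i i≤k))

    mono-shrink : ∀ d {i i′ j j′} → i Fin.≤ i′ → j′ Fin.≤ j → Mono d i j → Mono d i′ j′
    mono-shrink d i≤i′ j′≤j p k l i′≤k k<l l≤j′ =
      p k l (ℕₚ.≤-trans i≤i′ i′≤k) k<l (ℕₚ.≤-trans l≤j′ j′≤j)

  mono-unique : ∀ {n} (π : Permutation′ (suc n)) {d e} {k l : Fin n} →
                Mono π d zero (suc k) → Mono π e zero (suc l) → d ≡ e
  mono-unique {suc n} π {d} {e} p q = Lt-unique d e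
    (p zero (suc zero) z≤n (s≤s z≤n) (s≤s z≤n)) (q zero (suc zero) z≤n (s≤s z≤n) (s≤s z≤n))

  -- Counts the up-down runs when d is true, and those of the complement of π when d is false.
  opaque
    runs : ∀ {n} → Bool → Permutation′ (suc n) → ℕ
    runs d π = biruns π ℕ.+ indicator (does (maximal? π (mono? π d) zero zero))

    -- A birun has at least two letters and the initial run just one, so no pair satisfies both
    -- disjuncts and the count splits into a sum. The second summand can be nonzero only at the pair
    -- (0, 0).
    udr-runs : ∀ {n} (π : Permutation′ (suc n)) → udr π ≡ runs true π
    udr-runs {n} π = begin
      udr π
        ≡⟨ countPairs-sum (upDownRun? π) ⟩
      (sum λ i → count (upDownRun? π i))
        ≡⟨ ℕΣ.sum-cong-≗ (λ i → trans (ℕΣ.sum-cong-≗ (entry i))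
             (ℕΣ.∑-distrib-+ (λ j → indicator (does (birun? π i j))) (λ j → indicator (does (init? i j))))) ⟩
      (sum λ i → count (birun? π i) ℕ.+ count (init? i))
        ≡⟨ ℕΣ.∑-distrib-+ (λ i → count (birun? π i)) (λ i → count (init? i)) ⟩
      (sum λ i → count (birun? π i)) ℕ.+ (sum λ i → count (init? i))
        ≡⟨ cong (ℕ._+ (sum λ i → count (init? i))) (sym (pairs-sum (birun? π))) ⟩
      biruns π ℕ.+ (sum λ i → count (init? i))
        ≡⟨ cong (biruns π ℕ.+_) (cong₂ ℕ._+_
             (cong₂ ℕ._+_ corner (count-none (λ j → init? zero (suc j)) λ { j (_ , () , _) }))
             (trans (ℕΣ.sum-cong-≗ λ i → count-none (init? (suc i)) λ { j (() , _) }) (ℕΣ.sum-replicate-zero n))) ⟩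
      biruns π ℕ.+ (indicator first ℕ.+ 0 ℕ.+ 0)
        ≡⟨ cong (biruns π ℕ.+_) (trans (ℕₚ.+-identityʳ _) (ℕₚ.+-identityʳ _)) ⟩
      runs true π ∎
      where
      open ≡.≡-Reasoning

      first : Bool
      first = does (maximal? π (mono? π true) zero zero)

      Init : Fin (suc n) → Fin (suc n) → Set
      Init i j = toℕ i ≡ 0 × i ≡ j × IncreasingRun π i j

      init? : Decidable Init
      init? i j = (toℕ i ℕ.≟ 0) ×-dec ((i Fin.≟ j) ×-dec ((i Fin.≤? j) ×-dec maximal? π (increasing? π) i j))

      entry : ∀ i j → indicator (does (upDownRun? π i j)) ≡
              indicator (does (birun? π i j)) ℕ.+ indicator (does (init? i j))
      entry i j = indicator-⊎ (birun? π i j) (init? i j) λ { ((i<j , _) , (_ , refl , _)) → ℕₚ.<-irrefl refl i<j }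

      corner : indicator (does (init? zero zero)) ≡ indicator first
      corner = cong indicator (does-⇔ (mk⇔ (λ p → proj₂ (proj₂ (proj₂ p))) (λ p → refl , refl , z≤n , p))
        (init? zero zero) (maximal? π (mono? π true) zero zero))

    runs-singleton : ∀ d (π : Permutation′ 1) → runs d π ≡ 1
    runs-singleton d π = cong₂ ℕ._+_
      (trans (pairs-sum (birun? π)) (cong (λ c → c ℕ.+ 0) (count-none (birun? π zero) λ { zero (() , _) })))
      (cong indicator (dec-true (maximal? π (mono? π d) zero zero)
        (mono-refl π d zero , λ { zero zero _ _ _ → refl , refl })))

  -- Biruns after prefixing a letter

  module Insertion {n : ℕ} (j : Fin (suc (suc n))) (σ : Permutation′ (suc n)) where

    private
      π : Permutation′ (suc (suc n))
      π = insert zero j σ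

    -- The direction of the first step of `π`. The comparison is not strict because the letters of
    -- `σ` that are at least `j` are raised by one in `π`.
    rises : Bool
    rises = does (toℕ j ℕ.≤? toℕ (σ ⟨$⟩ʳ zero))

    private
      δ : Bool
      δ = rises

      rises-≤ : ∀ {m} (i : Fin (suc m)) (k : Fin m) → i Fin.≤ k → i Fin.< punchIn i k
      rises-≤ zero    k       _       = s≤s z≤n
      rises-≤ (suc i) (suc k) (s≤s p) = s≤s (rises-≤ i k p)

      first-step : Lt δ (π ⟨$⟩ʳ zero) (π ⟨$⟩ʳ suc zero)
      first-step = go (toℕ j ℕ.≤? toℕ (σ ⟨$⟩ʳ zero))
        where
        go : (p? : Dec (j Fin.≤ (σ ⟨$⟩ʳ zero))) → Lt (does p?) (π ⟨$⟩ʳ zero) (π ⟨$⟩ʳ suc zero)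
        go (yes p) = rises-≤ j _ p
        go (no ¬p) = Equivalence.from (punchIn<i j _) (ℕₚ.≰⇒> ¬p)

      Lt-σ⇔π : ∀ d k l → Lt d (σ ⟨$⟩ʳ k) (σ ⟨$⟩ʳ l) ⇔ Lt d (π ⟨$⟩ʳ suc k) (π ⟨$⟩ʳ suc l)
      Lt-σ⇔π true  k l = punchIn-< j _ _
      Lt-σ⇔π false k l = punchIn-< j _ _

      mono-up : ∀ d {i k} → Mono σ d i k → Mono π d (suc i) (suc k)
      mono-up d p (suc a) (suc b) (s≤s i≤a) (s≤s a<b) (s≤s b≤k) =
        Equivalence.to (Lt-σ⇔π d a b) (p a b i≤a a<b b≤k)

      mono-down : ∀ d {i k} → Mono π d (suc i) (suc k) → Mono σ d i k
      mono-down d p a b i≤a a<b b≤k =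
        Equivalence.from (Lt-σ⇔π d a b) (p (suc a) (suc b) (s≤s i≤a) (s≤s a<b) (s≤s b≤k))

      monotone-up : ∀ {i k} → Monotone σ i k → Monotone π (suc i) (suc k)
      monotone-up = ⊎.map (mono-up true) (mono-up false)

      monotone-down : ∀ {i k} → Monotone π (suc i) (suc k) → Monotone σ i k
      monotone-down = ⊎.map (mono-down true) (mono-down false)

      mono-extend : ∀ {k} → Mono σ δ zero k → Mono π δ zero (suc k)
      mono-extend p zero (suc zero) _ _ _ = first-step
      mono-extend p zero (suc (suc b)) _ _ (s≤s b≤k) = Lt-trans δ {y = π ⟨$⟩ʳ suc zero} first-step
        (mono-up δ p (suc zero) (suc (suc b)) (s≤s z≤n) (s≤s (s≤s z≤n)) (s≤s b≤k))
      mono-extend p (suc a) (suc b) _ a<b b≤k = mono-up δ p (suc a) (suc b) (s≤s z≤n) a<b b≤k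

      mono-direction : ∀ d {k} → Mono π d zero (suc k) → d ≡ δ
      mono-direction d p = Lt-unique d δ (p zero (suc zero) z≤n (s≤s z≤n) (s≤s z≤n)) first-step

      mono-start : ∀ {k} → Monotone π zero (suc k) → Mono π δ zero (suc k)
      mono-start {k} = fromMonotone π λ d p → ≡.subst (λ e → Mono π e zero (suc k)) (mono-direction d p) p

      mono-tail : ∀ {k} → Monotone π zero (suc k) → Mono σ δ zero k
      mono-tail p = mono-down δ (mono-shrink π δ z≤n ℕₚ.≤-refl (mono-start p))

      -- The new letter cannot interfere this far right: an extension back to it would, once it is
      -- dropped, be a monotone segment of `σ` from position 0, against maximality at `suc i`.
      birun-suc-suc : ∀ {i k} → Birun π (suc (suc i)) (suc k) ⇔ Birun σ (suc i) k
      birun-suc-suc {i} {k} = mk⇔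
        (λ { (s≤s i<k , p , max) → i<k , monotone-down p , λ i′ k′ i′≤ k≤ q →
          let (e , f) = max (suc i′) (suc k′) (s≤s i′≤) (s≤s k≤) (monotone-up q)
          in Finₚ.suc-injective e , Finₚ.suc-injective f })
        (λ { (i<k , p , max) → s≤s i<k , monotone-up p , λ
          { zero    (suc k′) i′≤ (s≤s k≤) q → ⊥-elim (Finₚ.0≢1+n (proj₁ (max zero k′ z≤n k≤ (toMonotone σ δ (mono-tail q)))))
          ; (suc i′) (suc k′) (s≤s i′≤) (s≤s k≤) q →
              let (e , f) = max i′ k′ i′≤ k≤ (monotone-down q) in cong suc e , cong suc f } })

      ¬birun-zero : ∀ i → ¬ Birun π i zero
      ¬birun-zero i (() , _)

      -- σ does not begin with a step in direction δ, which makes position 1 of π the start of a birun.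
      module Turn (max₀ : ∀ k → Mono σ δ zero k → k ≡ zero) where

        row₀ : ∀ k → Birun π zero (suc k) ⇔ k ≡ zero
        row₀ k = mk⇔ (λ { (_ , p , _) → max₀ k (mono-tail p) })
          (λ { refl → s≤s z≤n , toMonotone π δ (mono-extend (mono-refl σ δ zero)) , λ
            { zero (suc k′) _ _ q → refl , cong suc (max₀ k′ (mono-tail q)) } })

        row₁ : ∀ k → Birun π (suc zero) (suc k) ⇔ Birun σ zero k
        row₁ k = mk⇔
          (λ { (s≤s 0<k , p , max) → 0<k , monotone-down p , λ i′ k′ i′≤ k≤ q →
            let (e , f) = max (suc i′) (suc k′) (s≤s i′≤) (s≤s k≤) (monotone-up q)
            in Finₚ.suc-injective e , Finₚ.suc-injective f })
          (λ { (0<k , p , max) → s≤s 0<k , monotone-up p , λ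
            -- An extension over the new letter would have direction `δ`, so its part in `σ` is a
            -- single letter by `max₀`; but a birun has at least two.
            { zero (suc k′) _ (s≤s k≤) q → ⊥-elim (ℕₚ.<⇒≱ 0<k
                (ℕₚ.≤-trans k≤ (ℕₚ.≤-reflexive (cong toℕ (max₀ k′ (mono-tail q))))))
            ; (suc i′) (suc k′) (s≤s i′≤) (s≤s k≤) q →
                let (e , f) = max i′ k′ i′≤ k≤ (monotone-down q) in cong suc e , cong suc f } })

        biruns-turn : biruns π ≡ suc (biruns σ)
        biruns-turn = pairs-turn (birun? π) (birun? σ) ¬birun-zero row₀ λ
          { zero → row₁ ; (suc i) k → birun-suc-suc }

      -- The opposite case: `σ` begins with a step in direction `δ`, so its first birun is
      -- lengthened by the new letter.
      module Straight (k₀ : Fin n) (mono₀ : Mono σ δ zero (suc k₀)) where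

        start : ∀ {k} → Monotone σ zero (suc k) → Mono σ δ zero (suc k)
        start {k} = fromMonotone σ λ d p → ≡.subst (λ e → Mono σ e zero (suc k))
          (mono-unique σ p mono₀) p

        row₁ : ∀ k → ¬ Birun π (suc zero) (suc k)
        row₁ zero    (s≤s () , _)
        row₁ (suc k) (_ , p , max) = Finₚ.0≢1+n (proj₁ (max zero (suc (suc k)) z≤n ℕₚ.≤-refl
          (toMonotone π δ (mono-extend (start (monotone-down p))))))

        row₀ : ∀ k → Birun π zero (suc k) ⇔ Birun σ zero k
        row₀ zero = mk⇔
          (λ { (_ , _ , max) → ⊥-elim (Finₚ.0≢1+n (sym (Finₚ.suc-injective (proj₂
            (max zero (suc (suc k₀)) z≤n (s≤s z≤n) (toMonotone π δ (mono-extend mono₀))))))) })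
          (λ { (() , _) })
        row₀ (suc k) = mk⇔
          (λ { (_ , p , max) → s≤s z≤n , toMonotone σ δ (mono-tail p) , λ
            { zero (suc k′) _ k≤ q → refl , Finₚ.suc-injective (proj₂
                (max zero (suc (suc k′)) z≤n (s≤s k≤) (toMonotone π δ (mono-extend (start q))))) } })
          (λ { (_ , p , max) → s≤s z≤n , toMonotone π δ (mono-extend (start p)) , λ
            { zero (suc k′) _ (s≤s k≤) q → refl , cong suc (proj₂ (max zero k′ z≤n k≤ (toMonotone σ δ (mono-tail q)))) } })

        biruns-straight : biruns π ≡ biruns σ
        biruns-straight = pairs-straight (birun? π) (birun? σ) ¬birun-zero row₀ row₁ λ i k → birun-suc-suc

      maximal₀ : ∀ d → d ≢ δ → Maximal π (Mono π d) zero zero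
      maximal₀ d d≢δ = mono-refl π d zero , λ
        { zero zero    _ _ _ → refl , refl
        ; zero (suc k) _ _ p → ⊥-elim (d≢δ (mono-direction d p)) }

    opaque
      unfolding runs

      private
        -- The correction term in `runs δ σ` tests whether `σ` fails to begin in direction `δ`,
        -- which is exactly when the new letter opens a birun of its own.
        biruns-insert : biruns π ≡ runs δ σ
        biruns-insert = go (maximal? σ (mono? σ δ) zero zero)
          where
          go : (max? : Dec (Maximal σ (Mono σ δ) zero zero)) → biruns π ≡ biruns σ ℕ.+ indicator (does max?)
          go (yes (_ , max)) = trans (Turn.biruns-turn λ k p → proj₂ (max zero k z≤n z≤n p)) (sym (ℕₚ.+-comm (biruns σ) 1))
          go (no ¬max) = trans (straight (Finₚ.any? λ k → mono? σ δ zero (suc k))) (sym (ℕₚ.+-identityʳ _))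
            where
            straight : Dec (∃ λ k → Mono σ δ zero (suc k)) → biruns π ≡ biruns σ
            straight (yes (k , p)) = Straight.biruns-straight k p
            straight (no ¬p) = ⊥-elim (¬max (mono-refl σ δ zero , λ
              { zero zero    _ _ _ → refl , refl
              ; zero (suc k) _ _ p → ⊥-elim (¬p (k , p)) }))

      -- `π` begins in direction `rises`, so its own correction term vanishes for that direction and
      -- is one for the opposite direction. With `runs-insert-turn` this gives the two transfer
      -- matrices.
      runs-insert-same : runs rises π ≡ runs rises σ
      runs-insert-same = trans (cong (biruns π ℕ.+_) (cong indicator
          (dec-false (maximal? π (mono? π δ) zero zero) λ { (_ , max) →
            Finₚ.0≢1+n (sym (proj₂ (max zero (suc zero) z≤n z≤n (mono-extend (mono-refl σ δ zero))))) })))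
        (trans (ℕₚ.+-identityʳ _) biruns-insert)

      runs-insert-turn : runs (not rises) π ≡ suc (runs rises σ)
      runs-insert-turn = trans (cong (biruns π ℕ.+_) (cong indicator
          (dec-true (maximal? π (mono? π (not δ)) zero zero) (maximal₀ (not δ) (not-¬ (refl {x = δ}) ∘ sym)))))
        (trans (ℕₚ.+-comm (biruns π) 1) (cong suc biruns-insert))

open UpDownRuns using (inv-insert; runs; udr-runs; runs-singleton; module Insertion)

-- Sums over permutations, sorted by the first letter

≤ᵇ-suc : ∀ j k → (suc j ℕ.≤ᵇ suc k) ≡ (j ℕ.≤ᵇ k)
≤ᵇ-suc zero    k = ≡.refl
≤ᵇ-suc (suc j) k = ≡.refl

module Sums (R : CommutativeRing 0ℓ 0ℓ) where
  open CommutativeRing R hiding (zero)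
  open Algebra.Properties.CommutativeMonoid.Sum +-commutativeMonoid using (sum; sum-cong-≋; sum-replicate-zero)
  open SetoidReasoning setoid
  open Solver commutativeSemiring using (solve; _:=_; _:+_)

  sumList : ∀ {A : Set} → List A → (A → Carrier) → Carrier
  sumList xs W = foldr _+_ 0# (map W xs)

  module _ {A : Set} where

    sumList-cong : ∀ (xs : List A) {V W : A → Carrier} → (∀ x → V x ≈ W x) → sumList xs V ≈ sumList xs W
    sumList-cong []       p = refl
    sumList-cong (x ∷ xs) p = +-cong (p x) (sumList-cong xs p)

    sumList-+ : ∀ (xs : List A) (V W : A → Carrier) →
                sumList xs (λ x → V x + W x) ≈ sumList xs V + sumList xs W
    sumList-+ []       V W = sym (+-identityˡ 0#)
    sumList-+ (x ∷ xs) V W = trans (+-congˡ (sumList-+ xs V W))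
      (solve 4 (λ a b c d → a :+ b :+ (c :+ d) := a :+ c :+ (b :+ d)) refl (V x) (W x) _ _)

    sumList-*ˡ : ∀ (xs : List A) a (W : A → Carrier) → sumList xs (λ x → a * W x) ≈ a * sumList xs W
    sumList-*ˡ []       a W = sym (zeroʳ a)
    sumList-*ˡ (x ∷ xs) a W = trans (+-congˡ (sumList-*ˡ xs a W)) (sym (distribˡ a (W x) _))

    sumList-0 : ∀ (xs : List A) → sumList xs (λ _ → 0#) ≈ 0#
    sumList-0 []       = refl
    sumList-0 (x ∷ xs) = trans (+-identityˡ _) (sumList-0 xs)

  sumList-++-map : ∀ {A B : Set} (f : A → B) xs ys (W : B → Carrier) →
                   sumList (map f xs ++ ys) W ≈ sumList xs (W ∘ f) + sumList ys W
  sumList-++-map f []       ys W = sym (+-identityˡ _)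
  sumList-++-map f (x ∷ xs) ys W = trans (+-congˡ (sumList-++-map f xs ys W)) (sym (+-assoc _ _ _))

  sumList-product : ∀ {A B C : Set} (f : A → B → C) {n} (g : Fin n → A) ys (W : C → Carrier) →
                    sumList (cartesianProductWith f (tabulate g) ys) W ≈
                    sum λ i → sumList ys λ y → W (f (g i) y)
  sumList-product f {zero}  g ys W = refl
  sumList-product f {suc n} g ys W = trans
    (sumList-++-map (f (g zero)) ys (cartesianProductWith f (tabulate (g ∘ suc)) ys) W)
    (+-congˡ (sumList-product f (g ∘ suc) ys W))

  total : ∀ n → (Permutation′ n → Carrier) → Carrier
  total n = sumList (permutations n)

  total-suc : ∀ n (W : Permutation′ (suc n) → Carrier) →
              total (suc n) W ≈ sum λ j → total n λ σ → W (insert zero j σ)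
  total-suc n W = sumList-product (insert zero) (λ i → i) (permutations n) W

  pick : Bool → Bool → Carrier → Carrier
  pick true  true  x = x
  pick false false x = x
  pick _     _     x = 0#

  pick-*ˡ : ∀ d b a x → pick d b (a * x) ≈ a * pick d b x
  pick-*ˡ true  true  a x = refl
  pick-*ˡ true  false a x = sym (zeroʳ a)
  pick-*ˡ false true  a x = sym (zeroʳ a)
  pick-*ˡ false false a x = refl

  sumList-pick : ∀ {A : Set} (xs : List A) d b (W : A → Carrier) →
                 sumList xs (λ x → pick d b (W x)) ≈ pick d b (sumList xs W)
  sumList-pick xs true  true  W = refl
  sumList-pick xs true  false W = sumList-0 xs
  sumList-pick xs false true  W = sumList-0 xs
  sumList-pick xs false false W = refl

  -- part true j y sums y k over j ≤ k, and part false j y over k < j.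
  part : Bool → ∀ {n} → ℕ → (Fin n → Carrier) → Carrier
  part d j y = sum λ k → pick d (does (j ℕ.≤? toℕ k)) (y k)

  part-suc : ∀ d {n} j (y : Fin (suc n) → Carrier) → part d (suc j) y ≈ pick d false (y zero) + part d j (y ∘ suc)
  part-suc d j y = +-congˡ (sum-cong-≋ λ k →
    reflexive (≡.cong (λ b → pick d b (y (suc k))) (≤ᵇ-suc j (toℕ k))))

  part-true-step : ∀ {n} (y : Fin n → Carrier) j → part true (toℕ j) y ≈ y j + part true (suc (toℕ j)) y
  part-true-step y zero    = +-congˡ (sym (trans (part-suc true 0 y) (+-identityˡ _)))
  part-true-step y (suc j) = begin
    part true (suc (toℕ j)) y                     ≈⟨ trans (part-suc true (toℕ j) y) (+-identityˡ _) ⟩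
    part true (toℕ j) (y ∘ suc)                   ≈⟨ part-true-step (y ∘ suc) j ⟩
    y (suc j) + part true (suc (toℕ j)) (y ∘ suc) ≈⟨ +-congˡ (sym (trans (part-suc true (suc (toℕ j)) y) (+-identityˡ _))) ⟩
    y (suc j) + part true (suc (suc (toℕ j))) y   ∎

  part-true-end : ∀ {n} (y : Fin n → Carrier) → part true n y ≈ 0#
  part-true-end {zero}  y = refl
  part-true-end {suc n} y = trans (part-suc true n y) (trans (+-identityˡ _) (part-true-end (y ∘ suc)))

  part-false-0 : ∀ {n} (y : Fin n → Carrier) → part false 0 y ≈ 0#
  part-false-0 {n} y = sum-replicate-zero n

  part-false-step : ∀ {n} (y : Fin n → Carrier) j → part false (suc (toℕ j)) y ≈ part false (toℕ j) y + y j
  part-false-step y zero    = begin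
    part false 1 y                   ≈⟨ part-suc false 0 y ⟩
    y zero + part false 0 (y ∘ suc)  ≈⟨ +-comm _ _ ⟩
    part false 0 (y ∘ suc) + y zero  ≈⟨ +-congʳ (sym (+-identityˡ _)) ⟩
    part false 0 y + y zero          ∎
  part-false-step y (suc j) = begin
    part false (suc (suc (toℕ j))) y                        ≈⟨ part-suc false (suc (toℕ j)) y ⟩
    y zero + part false (suc (toℕ j)) (y ∘ suc)             ≈⟨ +-congˡ (part-false-step (y ∘ suc) j) ⟩
    y zero + (part false (toℕ j) (y ∘ suc) + y (suc j))     ≈⟨ sym (+-assoc _ _ _) ⟩
    y zero + part false (toℕ j) (y ∘ suc) + y (suc j)       ≈⟨ +-congʳ (sym (part-suc false (toℕ j) y)) ⟩
    part false (suc (toℕ j)) y + y (suc j)                  ∎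

  part-false-end : ∀ {n} (y : Fin n → Carrier) → part false n y ≈ sum y
  part-false-end {zero}  y = refl
  part-false-end {suc n} y = trans (part-suc false n y) (+-congˡ (part-false-end (y ∘ suc)))

-- The recurrence refined by the first letter

module FirstLetter (R : CommutativeRing 0ℓ 0ℓ) where
  open CommutativeRing R hiding (zero)
  open Algebra.Properties.CommutativeMonoid.Sum +-commutativeMonoid using (sum; sum-cong-≋)
  open Algebra.Properties.Semiring.Exp semiring using (_^_; ^-homo-*)
  open SetoidReasoning setoid
  open Solver commutativeSemiring using (solve; _:=_; _:+_; _:*_; con)
  open Sums R

  -- The two relations say that `(1, -v)` is a left eigenvector, with eigenvalue `w`, of the ascent
  -- matrix minus the descent matrix. Written without division, they make sense in every commutative
  -- ring.
  module Recurrence (q v s w : Carrier) (w+vs≈1 : w + v * s ≈ 1#) (s≈v+vw : s ≈ v + v * w) where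

    -v : Carrier
    -v = - v

    1-vs≈w : 1# + -v * s ≈ w
    1-vs≈w = begin
      1# + -v * s             ≈⟨ +-congʳ (sym w+vs≈1) ⟩
      w + v * s + -v * s      ≈⟨ solve 4 (λ w v s v′ → w :+ v :* s :+ v′ :* s := w :+ (v :+ v′) :* s) refl w v s -v ⟩
      w + (v + -v) * s        ≈⟨ +-congˡ (trans (*-congʳ (-‿inverseʳ v)) (zeroˡ s)) ⟩
      w + 0#                  ≈⟨ +-identityʳ w ⟩
      w                       ∎

    s-v≈vw : s + -v ≈ v * w
    s-v≈vw = begin
      s + -v              ≈⟨ +-congʳ s≈v+vw ⟩
      v + v * w + -v      ≈⟨ solve 3 (λ v x v′ → v :+ x :+ v′ := x :+ (v :+ v′)) refl v (v * w) -v ⟩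
      v * w + (v + -v)    ≈⟨ +-congˡ (-‿inverseʳ v) ⟩
      v * w + 0#          ≈⟨ +-identityʳ _ ⟩
      v * w               ∎

    s^runs : ∀ {n} → Bool → Permutation′ (suc n) → Carrier
    s^runs d π = s ^ runs d π

    -- Prefixing a step in direction b sends s^runs b to itself and s^runs (not b) to s · s^runs b.
    -- φ true and φ false are the eigenvectors, up to scalars, of the difference of these two
    -- rank-one transfer matrices, whose eigenvalues are ±w; hence φ-insert.
    φ : ∀ {n} → Bool → Permutation′ (suc n) → Carrier
    φ d π = s^runs d π + -v * s^runs (not d) π

    private
      same : ∀ a b {x y z} → x ≈ a → y ≈ s * a → z ≈ a + -v * b → x + -v * y ≈ w * (v * b + z)
      same a b {x} {y} {z} p r t = begin
        x + -v * y                    ≈⟨ +-cong p (*-congˡ r) ⟩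
        a + -v * (s * a)              ≈⟨ solve 3 (λ a s v′ → a :+ v′ :* (s :* a) := (con 1 :+ v′ :* s) :* a) refl a s -v ⟩
        (1# + -v * s) * a             ≈⟨ *-congʳ 1-vs≈w ⟩
        -- Zero is inserted as `(v + -v) * b` to split `a` into `v * b`, the term that also arises
        -- from a step in the other direction, and the value of `φ`.
        w * a                         ≈⟨ *-congˡ (sym (trans (+-congʳ (trans (*-congʳ (-‿inverseʳ v)) (zeroˡ b))) (+-identityˡ a))) ⟩
        w * ((v + -v) * b + a)        ≈⟨ *-congˡ (solve 4 (λ v v′ a b → (v :+ v′) :* b :+ a := v :* b :+ (a :+ v′ :* b)) refl v -v a b) ⟩
        w * (v * b + (a + -v * b))    ≈⟨ *-congˡ (+-congˡ (sym t)) ⟩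
        w * (v * b + z)               ∎

      turn : ∀ b {x y z} → x ≈ s * b → y ≈ b → z ≈ 0# → x + -v * y ≈ w * (v * b + z)
      turn b {x} {y} {z} p r t = begin
        x + -v * y          ≈⟨ +-cong p (*-congˡ r) ⟩
        s * b + -v * b      ≈⟨ sym (distribʳ b s -v) ⟩
        (s + -v) * b        ≈⟨ *-congʳ s-v≈vw ⟩
        v * w * b           ≈⟨ solve 3 (λ v w b → v :* w :* b := w :* (v :* b)) refl v w b ⟩
        w * (v * b)         ≈⟨ *-congˡ (sym (trans (+-congˡ t) (+-identityʳ _))) ⟩
        w * (v * b + z)     ∎

    -- The term with `not d` is the same whichever way the new step goes; only the eigenvector term
    -- depends on the direction, so that `j` will enter only through a range of summation.
    φ-insert : ∀ d {n} j (σ : Permutation′ (suc n)) →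
               φ d (insert zero j σ) ≈ w * (v * s^runs (not d) σ + pick d (Insertion.rises j σ) (φ d σ))
    φ-insert d j σ = go d (Insertion.rises j σ) (Insertion.runs-insert-same j σ) (Insertion.runs-insert-turn j σ)
      where
      π = insert zero j σ
      go : ∀ d b → runs b π ≡ runs b σ → runs (not b) π ≡ suc (runs b σ) →
           φ d π ≈ w * (v * s^runs (not d) σ + pick d b (φ d σ))
      go true  true  p r = same (s^runs true σ) (s^runs false σ) (reflexive (≡.cong (s ^_) p)) (reflexive (≡.cong (s ^_) r)) refl
      go false false p r = same (s^runs false σ) (s^runs true σ) (reflexive (≡.cong (s ^_) p)) (reflexive (≡.cong (s ^_) r)) refl
      go true  false p r = turn (s^runs false σ) (reflexive (≡.cong (s ^_) r)) (reflexive (≡.cong (s ^_) p)) refl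
      go false true  p r = turn (s^runs true σ) (reflexive (≡.cong (s ^_) r)) (reflexive (≡.cong (s ^_) p)) refl

    T : Bool → ℕ → Carrier
    T d n = total (suc n) λ π → q ^ inv π * s^runs d π

    -- c d zero is chosen to make Y-rec hold for permutations of length one as well.
    c : Bool → ℕ → Carrier
    c d zero    = s * (1# - v)
    c d (suc n) = v * w * T (not d) n

    -- At length zero there is no first letter, so `part` is empty there and the recurrence starts
    -- from `c d zero` alone.
    Y : Bool → ∀ n → Fin n → Carrier
    Y d (suc n) j = total n λ σ → q ^ inv (insert zero j σ) * φ d (insert zero j σ)

    Y-rec : ∀ d n j → Y d (suc n) j ≈ q ^ toℕ j * (c d n + w * part d (toℕ j) (Y d n))
    Y-rec d zero zero = begin
      q ^ inv π * φ d π + 0#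
        ≈⟨ +-identityʳ _ ⟩
      q ^ inv π * φ d π
        ≈⟨ *-cong (reflexive (≡.cong (q ^_) (inv-insert zero (Perm.id {0}))))
             (+-cong (reflexive (≡.cong (s ^_) (runs-singleton d π)))
                     (*-congˡ (reflexive (≡.cong (s ^_) (runs-singleton (not d) π))))) ⟩
      1# * (s * 1# + -v * (s * 1#))
        ≈⟨ *-congˡ (solve 3 (λ s v′ w → s :* con 1 :+ v′ :* (s :* con 1) := s :* (con 1 :+ v′) :+ w :* con 0) refl s -v w) ⟩
      1# * (s * (1# + -v) + w * 0#) ∎
      where
      π : Permutation′ 1
      π = insert zero zero (Perm.id {0})
    Y-rec d (suc n) j = begin
      (total (suc n) λ σ → q ^ inv (insert zero j σ) * φ d (insert zero j σ))
        ≈⟨ sumList-cong (permutations (suc n)) (λ σ → trans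
             (*-cong (trans (reflexive (≡.cong (q ^_) (inv-insert j σ))) (^-homo-* q (toℕ j) (inv σ))) (φ-insert d j σ))
             (solve 6 (λ a b w v x y → a :* b :* (w :* (v :* x :+ y)) := a :* (v :* w :* (b :* x) :+ w :* (b :* y))) refl
               (q ^ toℕ j) (q ^ inv σ) w v (s^runs (not d) σ) (pick d (Insertion.rises j σ) (φ d σ)))) ⟩
      (total (suc n) λ σ → q ^ toℕ j * (v * w * (q ^ inv σ * s^runs (not d) σ) + w * picked σ))
        ≈⟨ sumList-*ˡ (permutations (suc n)) (q ^ toℕ j) _ ⟩
      q ^ toℕ j * (total (suc n) λ σ → v * w * (q ^ inv σ * s^runs (not d) σ) + w * picked σ)
        ≈⟨ *-congˡ (sumList-+ (permutations (suc n)) _ _) ⟩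
      q ^ toℕ j * ((total (suc n) λ σ → v * w * (q ^ inv σ * s^runs (not d) σ)) + (total (suc n) λ σ → w * picked σ))
        ≈⟨ *-congˡ (+-cong (sumList-*ˡ (permutations (suc n)) (v * w) _) (sumList-*ˡ (permutations (suc n)) w _)) ⟩
      q ^ toℕ j * (c d (suc n) + w * total (suc n) picked)
        -- Sorting `σ` by its own first letter `k` turns the condition on the direction into a range
        -- for `k`.
        ≈⟨ *-congˡ (+-congˡ (*-congˡ (trans (total-suc n picked) (sum-cong-≋ picked-insert)))) ⟩
      q ^ toℕ j * (c d (suc n) + w * part d (toℕ j) (Y d (suc n))) ∎
      where
      picked : Permutation′ (suc n) → Carrier
      picked σ = q ^ inv σ * pick d (Insertion.rises j σ) (φ d σ)

      picked-insert : ∀ k → (total n λ τ → picked (insert zero k τ)) ≈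
                      pick d (does (toℕ j ℕ.≤? toℕ k)) (Y d (suc n) k)
      picked-insert k = trans
        (sumList-cong (permutations n) λ τ → sym (pick-*ˡ d b (q ^ inv (insert zero k τ)) (φ d (insert zero k τ))))
        (sumList-pick (permutations n) d b λ τ → q ^ inv (insert zero k τ) * φ d (insert zero k τ))
        where b = does (toℕ j ℕ.≤? toℕ k)

    sum-Y : ∀ d n → sum (Y d (suc n)) ≈ T d n + -v * T (not d) n
    sum-Y d n = begin
      sum (Y d (suc n))
        ≈⟨ sym (total-suc n λ π → q ^ inv π * φ d π) ⟩
      (total (suc n) λ π → q ^ inv π * φ d π)
        ≈⟨ sumList-cong (permutations (suc n)) (λ π →
             solve 4 (λ a x v′ y → a :* (x :+ v′ :* y) := a :* x :+ v′ :* (a :* y)) refl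
               (q ^ inv π) (s^runs d π) -v (s^runs (not d) π)) ⟩
      (total (suc n) λ π → q ^ inv π * s^runs d π + -v * (q ^ inv π * s^runs (not d) π))
        ≈⟨ sumList-+ (permutations (suc n)) _ _ ⟩
      T d n + (total (suc n) λ π → -v * (q ^ inv π * s^runs (not d) π))
        ≈⟨ +-congˡ (sumList-*ˡ (permutations (suc n)) -v _) ⟩
      T d n + -v * T (not d) n ∎

    -- Once normalised, `A true` and `A false` are the series p and r. The value at zero is the one
    -- that `A-sum` forces, since the sum over first letters is empty there.
    A : Bool → ℕ → Carrier
    A d zero    = s * (1# - v)
    A d (suc n) = w * T d n

    -- Summing `φ d` over all first letters leaves a deficit of `v` times the total for `not d`, and
    -- `c d` restores just that.
    A-sum : ∀ d n → c d n + w * sum (Y d n) ≈ A d n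
    A-sum d zero    = trans (+-congˡ (zeroʳ w)) (+-identityʳ _)
    A-sum d (suc n) = begin
      v * w * b + w * sum (Y d (suc n)) ≈⟨ +-congˡ (*-congˡ (sum-Y d n)) ⟩
      v * w * b + w * (a + -v * b)      ≈⟨ solve 5 (λ v w a b v′ → v :* w :* b :+ w :* (a :+ v′ :* b) := w :* (a :+ (v :+ v′) :* b)) refl v w a b -v ⟩
      w * (a + (v + -v) * b)            ≈⟨ *-congˡ (trans (+-congˡ (trans (*-congʳ (-‿inverseʳ v)) (zeroˡ b))) (+-identityʳ a)) ⟩
      w * a                             ∎
      where
      a = T d n
      b = T (not d) n

-- q-binomial expansions and division by q-factorials

module Expansion (R : CommutativeRing 0ℓ 0ℓ) (q w : CommutativeRing.Carrier R) where
  open CommutativeRing R hiding (zero)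
  open Algebra.Properties.CommutativeMonoid.Sum +-commutativeMonoid using (sum; sum-cong-≋)
  open Algebra.Properties.Semiring.Sum semiring using (*-distribˡ-sum; *-distribʳ-sum)
  open Algebra.Properties.Semiring.Exp semiring using (_^_; ^-homo-*; ^-congˡ)
  open Algebra.Properties.CommutativeSemiring.Exp commutativeSemiring using (^-distrib-*)
  open SetoidReasoning setoid
  open Solver commutativeSemiring using (solve; _:=_; _:+_; _:*_)
  open PowerSeries R
  open Division R using (Unit)
  open QNumbers R using (qInt; qFactorial)

  private
    [_] F : ℕ → Carrier
    [_] = qInt q
    F = qFactorial q

  qInt-+ : ∀ m n → qInt q (m ℕ.+ n) ≈ qInt q m + q ^ m * qInt q n
  qInt-+ m zero    = begin
    [ m ℕ.+ 0 ]        ≡⟨ ≡.cong [_] (ℕₚ.+-identityʳ m) ⟩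
    [ m ]              ≈⟨ sym (trans (+-congˡ (zeroʳ (q ^ m))) (+-identityʳ _)) ⟩
    [ m ] + q ^ m * 0# ∎
  qInt-+ m (suc n) = begin
    [ m ℕ.+ suc n ]                             ≡⟨ ≡.cong [_] (ℕₚ.+-suc m n) ⟩
    [ m ℕ.+ n ] + q ^ (m ℕ.+ n)                 ≈⟨ +-cong (qInt-+ m n) (^-homo-* q m n) ⟩
    [ m ] + q ^ m * [ n ] + q ^ m * q ^ n       ≈⟨ solve 4 (λ a b c d → a :+ b :* c :+ b :* d := a :+ b :* (c :+ d)) refl _ _ _ _ ⟩
    [ m ] + q ^ m * ([ n ] + q ^ n)             ∎

  1^n≈1 : ∀ n → 1# ^ n ≈ 1#
  1^n≈1 zero    = refl
  1^n≈1 (suc n) = trans (*-identityˡ _) (1^n≈1 n)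

  -- The relation f = f′ + a x f″ of series, multiplied by `c`. It carries the Pascal-type
  -- recurrences of `falling` and `rising` over to convolutions.
  *ₛ-step : ∀ {f f′ f″ : Series} (c : Series) a → f 0 ≈ f′ 0 → (∀ i → f (suc i) ≈ f′ (suc i) + a * f″ i) →
            ∀ n → (f *ₛ c) (suc n) ≈ (f′ *ₛ c) (suc n) + a * (f″ *ₛ c) n
  *ₛ-step {f} {f′} {f″} c a p r n = begin
    (f *ₛ c) (suc n)
      ≡⟨ *ₛ-suc f c n ⟩
    f 0 * c (suc n) + (tail f *ₛ c) n
      ≈⟨ +-cong (*-congʳ p) (*ₛ-cong {tail f} {tail f′ +ₛ a ·ₛ f″} {c} {c} r (λ _ → refl) n) ⟩
    f′ 0 * c (suc n) + ((tail f′ +ₛ a ·ₛ f″) *ₛ c) n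
      ≈⟨ +-congˡ (*ₛ-distribʳ c (tail f′) (a ·ₛ f″) n) ⟩
    f′ 0 * c (suc n) + ((tail f′ *ₛ c) n + ((a ·ₛ f″) *ₛ c) n)
      ≈⟨ sym (+-assoc _ _ _) ⟩
    f′ 0 * c (suc n) + (tail f′ *ₛ c) n + ((a ·ₛ f″) *ₛ c) n
      ≈⟨ +-cong (reflexive (≡.sym (*ₛ-suc f′ c n))) (·ₛ-*ₛ-assoc a f″ c n) ⟩
    (f′ *ₛ c) (suc n) + a * (f″ *ₛ c) n ∎

  -- falling j = (1 + w x)(1 + w q x) ⋯ (1 + w q^(j-1) x); its coefficients and those of rising m j
  -- are q-binomial coefficients up to powers of w and q, see falling-closed and rising-closed.
  falling : ℕ → Series
  falling zero    = 1ₛ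
  falling (suc j) zero    = 1#
  falling (suc j) (suc i) = falling j (suc i) + w * q ^ j * falling j i

  rising : ℕ → ℕ → Series
  rising zero    j = 1ₛ
  rising (suc m) j zero    = 1#
  rising (suc m) j (suc i) = rising m (suc j) (suc i) + w * q ^ j * rising m j i

  falling-0 : ∀ j → falling j 0 ≈ 1#
  falling-0 zero    = refl
  falling-0 (suc j) = refl

  rising-0 : ∀ m j → rising m j 0 ≈ 1#
  rising-0 zero    j = refl
  rising-0 (suc m) j = refl

  private
    both-0 : ∀ {a b c} → a ≈ 0# → b ≈ 0# → a + c * b ≈ 0#
    both-0 {a} {b} {c} p r = trans (+-cong p (trans (*-congˡ r) (zeroʳ c))) (+-identityʳ 0#)

  falling-vanishes : ∀ j i → j ℕ.< i → falling j i ≈ 0#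
  falling-vanishes zero    (suc i) _         = refl
  falling-vanishes (suc j) (suc i) (s≤s j<i) =
    both-0 (falling-vanishes j (suc i) (ℕₚ.m≤n⇒m≤1+n j<i)) (falling-vanishes j i j<i)

  rising-vanishes : ∀ m j i → m ℕ.< i → rising m j i ≈ 0#
  rising-vanishes zero    j (suc i) _         = refl
  rising-vanishes (suc m) j (suc i) (s≤s m<i) =
    both-0 (rising-vanishes m (suc j) (suc i) (ℕₚ.m≤n⇒m≤1+n m<i)) (rising-vanishes m j i m<i)

  suc-C-2 : ∀ k → q ^ (suc k C 2) ≈ q ^ k * q ^ (k C 2)
  suc-C-2 k = begin
    q ^ (suc k C 2)           ≡⟨ ≡.cong (q ^_) (≡.sym (nCk+nC[k+1]≡[n+1]C[k+1] k 1)) ⟩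
    q ^ (k C 1 ℕ.+ k C 2)     ≡⟨ ≡.cong (λ m → q ^ (m ℕ.+ k C 2)) (nC1≡n k) ⟩
    q ^ (k ℕ.+ k C 2)         ≈⟨ ^-homo-* q k (k C 2) ⟩
    q ^ k * q ^ (k C 2)       ∎

  private
    -- A q-Pascal step with factorials cleared: `b * c` is `F (suc k)`, and `p + r` is one of the
    -- two splittings of `[ suc k + d ]`, namely `[ d ] + q ^ d * [ suc k ]` or
    -- `q ^ suc k * [ d ] + [ suc k ]`.
    combine : ∀ {x y a b c e z f p r} → x * (b * c) * e ≈ z * f * p → a * c * (y * b * e) ≈ z * f * r →
              (x + a * y) * (b * c) * e ≈ z * (f * (p + r))
    combine {x} {y} {a} {b} {c} {e} {z} {f} {p} {r} P R = begin
      (x + a * y) * (b * c) * e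
        ≈⟨ solve 6 (λ x a y b c e → (x :+ a :* y) :* (b :* c) :* e := x :* (b :* c) :* e :+ a :* c :* (y :* b :* e)) refl x a y b c e ⟩
      x * (b * c) * e + a * c * (y * b * e)
        ≈⟨ +-cong P R ⟩
      z * f * p + z * f * r
        ≈⟨ solve 4 (λ z f p r → z :* f :* p :+ z :* f :* r := z :* (f :* (p :+ r))) refl z f p r ⟩
      z * (f * (p + r)) ∎

    qInt-comm : ∀ m n → [ n ] + q ^ n * [ m ] ≈ [ m ℕ.+ n ]
    qInt-comm m n = trans (sym (qInt-+ n m)) (reflexive (≡.cong [_] (ℕₚ.+-comm n m)))

    -- Indexing by `k` and the complement `d` avoids subtraction, and multiplying by `F k * F d`
    -- avoids dividing by q-factorials, which need not be units here.
    FallingClosed RisingClosed : ℕ → ℕ → Set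
    FallingClosed k d = falling (k ℕ.+ d) k * F k * F d ≈ w ^ k * q ^ (k C 2) * F (k ℕ.+ d)
    RisingClosed k d = ∀ j → rising (k ℕ.+ d) j k * F k * F d ≈ (w * q ^ j) ^ k * F (k ℕ.+ d)

    -- The second hypothesis is the closed form at `suc k` and `d - 1` multiplied by `[ d ]`. For
    -- `d = 0` it comes from vanishing on both sides, hence its separate formulation.
    falling-step : ∀ k d → FallingClosed k d →
      falling (k ℕ.+ d) (suc k) * F (suc k) * F d ≈ w ^ suc k * q ^ (suc k C 2) * F (k ℕ.+ d) * [ d ] →
      FallingClosed (suc k) d
    falling-step k d closed upper = trans (combine upper lower) (*-congˡ (*-congˡ (qInt-comm (suc k) d)))
      where
      Q = q ^ (k C 2)

      lower : w * q ^ (k ℕ.+ d) * [ suc k ] * (falling (k ℕ.+ d) k * F k * F d) ≈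
              w ^ suc k * q ^ (suc k C 2) * F (k ℕ.+ d) * (q ^ d * [ suc k ])
      lower = begin
        w * q ^ (k ℕ.+ d) * [ suc k ] * (falling (k ℕ.+ d) k * F k * F d)
          ≈⟨ *-cong (*-congʳ (*-congˡ (^-homo-* q k d))) closed ⟩
        w * (q ^ k * q ^ d) * [ suc k ] * (w ^ k * Q * F (k ℕ.+ d))
          ≈⟨ solve 7 (λ w a c e z Q f → w :* (a :* c) :* e :* (z :* Q :* f) := w :* z :* (a :* Q) :* f :* (c :* e)) refl
               w (q ^ k) (q ^ d) [ suc k ] (w ^ k) Q (F (k ℕ.+ d)) ⟩
        w * w ^ k * (q ^ k * Q) * F (k ℕ.+ d) * (q ^ d * [ suc k ])
          ≈⟨ *-congʳ (*-congʳ (*-congˡ (sym (suc-C-2 k)))) ⟩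
        w ^ suc k * q ^ (suc k C 2) * F (k ℕ.+ d) * (q ^ d * [ suc k ]) ∎

    -- This is the other q-Pascal rule: raising `j` by one contributes the factor `q ^ suc k`, so
    -- the closed form must be known for all `j` at once.
    rising-step : ∀ k d → RisingClosed k d →
      (∀ j → rising (k ℕ.+ d) j (suc k) * F (suc k) * F d ≈ (w * q ^ j) ^ suc k * F (k ℕ.+ d) * [ d ]) →
      RisingClosed (suc k) d
    rising-step k d closed upper j = trans
      (combine {f = F (k ℕ.+ d)} {p = q ^ suc k * [ d ]} {r = [ suc k ]} shifted lower)
      (*-congˡ (*-congˡ (trans (+-comm _ _) (sym (qInt-+ (suc k) d)))))
      where
      a = w * q ^ j
      f = F (k ℕ.+ d)

      shifted : rising (k ℕ.+ d) (suc j) (suc k) * F (suc k) * F d ≈ a ^ suc k * f * (q ^ suc k * [ d ])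
      shifted = begin
        rising (k ℕ.+ d) (suc j) (suc k) * F (suc k) * F d
          ≈⟨ upper (suc j) ⟩
        (w * (q * q ^ j)) ^ suc k * f * [ d ]
          ≈⟨ *-congʳ (*-congʳ (^-congˡ (suc k) (solve 3 (λ w q x → w :* (q :* x) := w :* x :* q) refl w q (q ^ j)))) ⟩
        (a * q) ^ suc k * f * [ d ]
          ≈⟨ *-congʳ (*-congʳ (^-distrib-* a q (suc k))) ⟩
        a ^ suc k * q ^ suc k * f * [ d ]
          ≈⟨ solve 4 (λ a b f d → a :* b :* f :* d := a :* f :* (b :* d)) refl (a ^ suc k) (q ^ suc k) f [ d ] ⟩
        a ^ suc k * f * (q ^ suc k * [ d ]) ∎

      lower : a * [ suc k ] * (rising (k ℕ.+ d) j k * F k * F d) ≈ a ^ suc k * f * [ suc k ]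
      lower = trans (*-congˡ (closed j))
        (solve 4 (λ a b c f → a :* b :* (c :* f) := a :* c :* f :* b) refl a [ suc k ] (a ^ k) f)

    vanish : ∀ {x y z u} → x ≈ 0# → x * y * z ≈ u * 0#
    vanish {x} {y} {z} {u} p = trans (trans (*-congʳ (trans (*-congʳ p) (zeroˡ y))) (zeroˡ z)) (sym (zeroʳ u))

  -- The q-binomial theorem for the finite product, with the coefficient of x^k read off.
  falling-closed : ∀ k d → falling (k ℕ.+ d) k * F k * F d ≈ w ^ k * q ^ (k C 2) * F (k ℕ.+ d)
  falling-closed zero    d       = *-congʳ (*-congʳ (falling-0 d))
  falling-closed (suc k) zero    = falling-step k zero (falling-closed k zero)
    (vanish (falling-vanishes _ _ (ℕₚ.≤-reflexive (≡.cong suc (ℕₚ.+-identityʳ k)))))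
  falling-closed (suc k) (suc d) = falling-step k (suc d) (falling-closed k (suc d))
    (≡.subst (λ m → falling m (suc k) * F (suc k) * F (suc d) ≈ w ^ suc k * q ^ (suc k C 2) * F m * [ suc d ])
      (≡.sym (ℕₚ.+-suc k d))
      (trans (sym (*-assoc _ _ _)) (*-congʳ (falling-closed (suc k) d))))

  rising-closed : ∀ k d j → rising (k ℕ.+ d) j k * F k * F d ≈ (w * q ^ j) ^ k * F (k ℕ.+ d)
  rising-closed zero    d       j = *-congʳ (trans (*-congʳ (rising-0 d j)) (*-identityʳ 1#))
  rising-closed (suc k) zero      = rising-step k zero (rising-closed k zero)
    λ j → vanish (rising-vanishes _ j _ (ℕₚ.≤-reflexive (≡.cong suc (ℕₚ.+-identityʳ k))))
  rising-closed (suc k) (suc d)   = rising-step k (suc d) (rising-closed k (suc d)) λ j →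
    ≡.subst (λ m → rising m j (suc k) * F (suc k) * F (suc d) ≈ (w * q ^ j) ^ suc k * F m * [ suc d ])
      (≡.sym (ℕₚ.+-suc k d))
      (trans (sym (*-assoc _ _ _)) (*-congʳ (rising-closed (suc k) d j)))

  module Normalisation (W : Carrier) (Ww≈1 : W * w ≈ 1#) (F-unit : ∀ n → Unit (F n)) where

    F⁻¹ : ℕ → Carrier
    F⁻¹ n = proj₁ (F-unit n)

    F*F⁻¹ : ∀ n → F n * F⁻¹ n ≈ 1#
    F*F⁻¹ n = proj₂ (proj₂ (F-unit n))

    normalise : Series → Series
    normalise f n = W ^ n * f n * F⁻¹ n

    -- Dividing by q-factorials turns a q-binomial convolution into a product of series, and `W ^ k`
    -- cancels `w ^ k`. Only one coefficient is treated because `f` will itself depend on `n`, as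
    -- `falling n` and `rising n 0` do.
    normalise-* : ∀ f (c : Series) (coef : ℕ → Carrier) n →
                  (∀ k d → k ℕ.+ d ≡ n → f k * F k * F d ≈ w ^ k * coef k * F n) →
                  normalise (f *ₛ c) n ≈ ((λ k → coef k * F⁻¹ k) *ₛ normalise c) n
    normalise-* f c coef n closed = begin
      W ^ n * (f *ₛ c) n * F⁻¹ n
        ≡⟨ ≡.cong (λ x → W ^ n * x * F⁻¹ n) (*ₛ-sum f c n) ⟩
      W ^ n * sum {suc n} (λ i → f (toℕ i) * c (n ∸ toℕ i)) * F⁻¹ n
        ≈⟨ *-congʳ (*-distribˡ-sum (W ^ n) (λ (i : Fin (suc n)) → f (toℕ i) * c (n ∸ toℕ i))) ⟩
      sum {suc n} (λ i → W ^ n * (f (toℕ i) * c (n ∸ toℕ i))) * F⁻¹ n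
        ≈⟨ *-distribʳ-sum (F⁻¹ n) (λ (i : Fin (suc n)) → W ^ n * (f (toℕ i) * c (n ∸ toℕ i))) ⟩
      sum {suc n} (λ i → W ^ n * (f (toℕ i) * c (n ∸ toℕ i)) * F⁻¹ n)
        ≈⟨ sum-cong-≋ (λ (i : Fin (suc n)) → term (toℕ i) (n ∸ toℕ i) (ℕₚ.m+[n∸m]≡n (Finₚ.toℕ≤pred[n] i))) ⟩
      sum {suc n} (λ i → coef (toℕ i) * F⁻¹ (toℕ i) * normalise c (n ∸ toℕ i))
        ≡⟨ ≡.sym (*ₛ-sum (λ k → coef k * F⁻¹ k) (normalise c) n) ⟩
      ((λ k → coef k * F⁻¹ k) *ₛ normalise c) n ∎
      where
      term : ∀ k d → k ℕ.+ d ≡ n → W ^ n * (f k * c d) * F⁻¹ n ≈ coef k * F⁻¹ k * (W ^ d * c d * F⁻¹ d)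
      term k d k+d≡n = begin
        W ^ n * (f k * c d) * F⁻¹ n
          ≈⟨ *-congʳ (*-cong (trans (reflexive (≡.cong (W ^_) (≡.sym k+d≡n))) (^-homo-* W k d)) (*-congʳ f≈)) ⟩
        W ^ k * W ^ d * (w ^ k * coef k * F n * (F⁻¹ k * F⁻¹ d) * c d) * F⁻¹ n
          ≈⟨ solve 9 (λ a b w x y k d c n → a :* b :* (w :* x :* y :* (k :* d) :* c) :* n :=
                                            (a :* w) :* (y :* n) :* (x :* k :* (b :* c :* d))) refl
               (W ^ k) (W ^ d) (w ^ k) (coef k) (F n) (F⁻¹ k) (F⁻¹ d) (c d) (F⁻¹ n) ⟩
        W ^ k * w ^ k * (F n * F⁻¹ n) * (coef k * F⁻¹ k * (W ^ d * c d * F⁻¹ d))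
          ≈⟨ *-congʳ (*-cong (trans (sym (^-distrib-* W w k)) (trans (^-congˡ k Ww≈1) (1^n≈1 k))) (F*F⁻¹ n)) ⟩
        1# * 1# * (coef k * F⁻¹ k * (W ^ d * c d * F⁻¹ d))
          ≈⟨ trans (*-congʳ (*-identityˡ 1#)) (*-identityˡ _) ⟩
        coef k * F⁻¹ k * (W ^ d * c d * F⁻¹ d) ∎
        where
        f≈ : f k ≈ w ^ k * coef k * F n * (F⁻¹ k * F⁻¹ d)
        f≈ = begin
          f k ≈⟨ sym (trans (*-congˡ (*-cong (F*F⁻¹ k) (F*F⁻¹ d))) (trans (*-congˡ (*-identityˡ 1#)) (*-identityʳ (f k)))) ⟩
          f k * ((F k * F⁻¹ k) * (F d * F⁻¹ d))
            ≈⟨ solve 5 (λ f a b c d → f :* ((a :* b) :* (c :* d)) := f :* a :* c :* (b :* d)) refl (f k) (F k) (F⁻¹ k) (F d) (F⁻¹ d) ⟩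
          f k * F k * F d * (F⁻¹ k * F⁻¹ d) ≈⟨ *-congʳ (closed k d k+d≡n) ⟩
          w ^ k * coef k * F n * (F⁻¹ k * F⁻¹ d) ∎

-- Eliminating one of the two coupled series

module Elimination (R : CommutativeRing 0ℓ 0ℓ) where
  open CommutativeRing R hiding (zero)
  open Algebra.Properties.Ring ring using (+-cancelˡ)
  open SetoidReasoning setoid
  open Solver commutativeSemiring using (solve; _:=_; _:+_; _:*_; con)

  -- Substituting `r` into the equation for `p` determines `D * p`. Since `κ * W * a` is `v`, the
  -- series `1# + κ * Q` equals `u + κ * W * p`, so this suffices.
  eliminate : ∀ {e E v u a w W κ p r Q D} →
              p ≈ e * (v * r + a * u) → r ≈ E * (v * p + a * u) → p ≈ a + w * Q →
              u + v ≈ 1# → v * v * e * E + D ≈ 1# → W * w ≈ 1# → κ * W * a ≈ v →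
              D * (1# + κ * Q) ≈ u * (1# + v * e)
  eliminate {e} {E} {v} {u} {a} {w} {W} {κ} {p} {r} {Q} {D} p≈ r≈ p-Q u+v≈1 D≈ Ww≈1 κWa≈v = begin
    D * (1# + κ * Q)
      ≈⟨ *-congˡ (+-congʳ (sym u+v≈1)) ⟩
    D * (u + v + κ * Q)
      ≈⟨ *-congˡ (+-cong (+-congˡ (sym κWa≈v)) (*-congˡ (sym (trans (*-congʳ Ww≈1) (*-identityˡ Q))))) ⟩
    D * (u + κ * W * a + κ * (W * w * Q))
      ≈⟨ solve 7 (λ D u k W a w Q → D :* (u :+ k :* W :* a :+ k :* (W :* w :* Q)) := D :* u :+ k :* W :* (D :* (a :+ w :* Q))) refl D u κ W a w Q ⟩
    D * u + κ * W * (D * (a + w * Q))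
      ≈⟨ +-congˡ (*-congˡ (trans (*-congˡ (sym p-Q)) Dp≈)) ⟩
    D * u + κ * W * (a * (u * e * (1# + v * E)))
      ≈⟨ +-congˡ (trans (sym (*-assoc _ _ _)) (*-congʳ κWa≈v)) ⟩
    D * u + v * (u * e * (1# + v * E))
      ≈⟨ solve 5 (λ D u v e E → D :* u :+ v :* (u :* e :* (con 1 :+ v :* E)) := u :* (v :* v :* e :* E :+ D :+ v :* e)) refl D u v e E ⟩
    u * (v * v * e * E + D + v * e)
      ≈⟨ *-congˡ (+-congʳ D≈) ⟩
    u * (1# + v * e) ∎
    where
    Dp≈ : D * p ≈ a * (u * e * (1# + v * E))
    -- Adding the same term to both sides keeps the computation free of negatives.
    Dp≈ = +-cancelˡ (v * v * e * E * p) _ _ (begin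
      v * v * e * E * p + D * p     ≈⟨ sym (distribʳ p _ D) ⟩
      (v * v * e * E + D) * p       ≈⟨ trans (*-congʳ D≈) (*-identityˡ p) ⟩
      p                             ≈⟨ trans p≈ (*-congˡ (+-congʳ (*-congˡ r≈))) ⟩
      e * (v * (E * (v * p + a * u)) + a * u)
        ≈⟨ solve 6 (λ e v E p a u → e :* (v :* (E :* (v :* p :+ a :* u)) :+ a :* u) :=
                                    v :* v :* e :* E :* p :+ a :* (u :* e :* (con 1 :+ v :* E))) refl e v E p a u ⟩
      v * v * e * E * p + a * (u * e * (1# + v * E)) ∎)

  unit-cancelˡ : ∀ {x} y z → Division.Unit R x → x * y ≈ x * z → y ≈ z
  unit-cancelˡ {x} y z (x⁻¹ , x⁻¹x≈1 , _) xy≈xz = begin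
    y             ≈⟨ sym (trans (*-congʳ x⁻¹x≈1) (*-identityˡ y)) ⟩
    x⁻¹ * x * y   ≈⟨ *-assoc x⁻¹ x y ⟩
    x⁻¹ * (x * y) ≈⟨ *-congˡ xy≈xz ⟩
    x⁻¹ * (x * z) ≈⟨ sym (*-assoc x⁻¹ x z) ⟩
    x⁻¹ * x * z   ≈⟨ trans (*-congʳ x⁻¹x≈1) (*-identityˡ z) ⟩
    z             ∎

  x-y+y≈x : ∀ x y → x - y + y ≈ x
  x-y+y≈x x y = trans (+-assoc x (- y) y) (trans (+-congˡ (-‿inverseˡ y)) (+-identityʳ x))

-- The functional equations and the identity they imply

module RunIdentity (R : CommutativeRing 0ℓ 0ℓ) where
  open CommutativeRing R hiding (zero)
  open Algebra.Properties.Semiring.Exp semiring using (_^_; ^-congˡ)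
  open SetoidReasoning setoid
  open Solver commutativeSemiring using (solve; _:=_; _:+_; _:*_; con)
  open PowerSeries R
  open Division R using (Unit; _/_[_])
  open QNumbers R using (qFactorial; P)
  open Sums R
  open FirstLetter R

  private
    module S = CommutativeRing seriesRing

  module Identity (q v s w W κ : Carrier) (w+vs≈1 : w + v * s ≈ 1#) (s≈v+vw : s ≈ v + v * w)
                  (Ww≈1 : W * w ≈ 1#) (κWsu≈v : κ * W * (s * (1# - v)) ≈ v)
                  (F-unit : ∀ n → Unit (qFactorial q n)) where

    open Recurrence q v s w w+vs≈1 s≈v+vw
    open Expansion R q w
    open Normalisation W Ww≈1 F-unit
    open QExponentials R q F-unit

    -- The bracket in `Y-rec`. The range is complete for `true` at `j = 0` and for `false` at
    -- `j = n`, where this becomes `A d n`.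
    partial : Bool → ℕ → Series
    partial d j n = c d n + w * part d j (Y d n)

    -- Moving the threshold past `i` drops one value of `Y`, which `Y-rec` expresses by the same
    -- bracket at the previous length. This is the recursion that defines `rising`.
    partial-suc-true : ∀ n (i : Fin (suc n)) →
      partial true (toℕ i) (suc n) ≈ partial true (suc (toℕ i)) (suc n) + w * q ^ toℕ i * partial true (toℕ i) n
    partial-suc-true n i = begin
      c true (suc n) + w * part true (toℕ i) (Y true (suc n))
        ≈⟨ +-congˡ (*-congˡ (trans (part-true-step (Y true (suc n)) i) (+-congʳ (Y-rec true n i)))) ⟩
      c true (suc n) + w * (q ^ toℕ i * partial true (toℕ i) n + part true (suc (toℕ i)) (Y true (suc n)))
        ≈⟨ solve 5 (λ c w a b d → c :+ w :* (a :* b :+ d) := c :+ w :* d :+ w :* a :* b) refl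
             (c true (suc n)) w (q ^ toℕ i) (partial true (toℕ i) n) _ ⟩
      partial true (suc (toℕ i)) (suc n) + w * q ^ toℕ i * partial true (toℕ i) n ∎

    partial-suc-false : ∀ n (i : Fin (suc n)) →
      partial false (suc (toℕ i)) (suc n) ≈ partial false (toℕ i) (suc n) + w * q ^ toℕ i * partial false (toℕ i) n
    partial-suc-false n i = begin
      c false (suc n) + w * part false (suc (toℕ i)) (Y false (suc n))
        ≈⟨ +-congˡ (*-congˡ (trans (part-false-step (Y false (suc n)) i) (+-congˡ (Y-rec false n i)))) ⟩
      c false (suc n) + w * (part false (toℕ i) (Y false (suc n)) + q ^ toℕ i * partial false (toℕ i) n)
        ≈⟨ solve 5 (λ c w a b d → c :+ w :* (d :+ a :* b) := c :+ w :* d :+ w :* a :* b) refl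
             (c false (suc n)) w (q ^ toℕ i) (partial false (toℕ i) n) _ ⟩
      partial false (toℕ i) (suc n) + w * q ^ toℕ i * partial false (toℕ i) n ∎

    -- At `j = n` the range is empty and only `c true` remains, so the induction is on the distance
    -- `m` from `j` to the length.
    partial-true : ∀ m j → partial true j (j ℕ.+ m) ≈ (rising m j *ₛ c true) (j ℕ.+ m)
    partial-true zero    j = ≡.subst (λ n → partial true j n ≈ (1ₛ *ₛ c true) n) (≡.sym (ℕₚ.+-identityʳ j)) (begin
      c true j + w * part true j (Y true j) ≈⟨ +-congˡ (trans (*-congˡ (part-true-end (Y true j))) (zeroʳ w)) ⟩
      c true j + 0#                         ≈⟨ +-identityʳ _ ⟩
      c true j                              ≈⟨ sym (*ₛ-identityˡ (c true) j) ⟩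
      (1ₛ *ₛ c true) j                      ∎)
    partial-true (suc m) j = ≡.subst (λ n → partial true j n ≈ (rising (suc m) j *ₛ c true) n) (≡.sym (ℕₚ.+-suc j m)) (begin
      partial true j (suc (j ℕ.+ m))
        ≈⟨ ≡.subst (λ i → partial true i (suc (j ℕ.+ m)) ≈ partial true (suc i) (suc (j ℕ.+ m)) + w * q ^ i * partial true i (j ℕ.+ m))
             (Finₚ.toℕ-fromℕ< (s≤s (ℕₚ.m≤m+n j m))) (partial-suc-true (j ℕ.+ m) (Fin.fromℕ< (s≤s (ℕₚ.m≤m+n j m)))) ⟩
      partial true (suc j) (suc j ℕ.+ m) + w * q ^ j * partial true j (j ℕ.+ m)
        ≈⟨ +-cong (partial-true m (suc j)) (*-congˡ (partial-true m j)) ⟩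
      (rising m (suc j) *ₛ c true) (suc j ℕ.+ m) + w * q ^ j * (rising m j *ₛ c true) (j ℕ.+ m)
        ≈⟨ sym (*ₛ-step {rising (suc m) j} {rising m (suc j)} {rising m j} (c true) (w * q ^ j)
             (sym (rising-0 m (suc j))) (λ _ → refl) (j ℕ.+ m)) ⟩
      (rising (suc m) j *ₛ c true) (suc (j ℕ.+ m)) ∎)

    partial-false : ∀ j n → j ℕ.≤ n → partial false j n ≈ (falling j *ₛ c false) n
    partial-false zero    n       _         = begin
      c false n + w * part false 0 (Y false n) ≈⟨ +-congˡ (trans (*-congˡ (part-false-0 (Y false n))) (zeroʳ w)) ⟩
      c false n + 0#                           ≈⟨ +-identityʳ _ ⟩
      c false n                                ≈⟨ sym (*ₛ-identityˡ (c false) n) ⟩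
      (1ₛ *ₛ c false) n                        ∎
    partial-false (suc j) (suc n) (s≤s j≤n) = begin
      partial false (suc j) (suc n)
        ≈⟨ ≡.subst (λ i → partial false (suc i) (suc n) ≈ partial false i (suc n) + w * q ^ i * partial false i n)
             (Finₚ.toℕ-fromℕ< (s≤s j≤n)) (partial-suc-false n (Fin.fromℕ< (s≤s j≤n))) ⟩
      partial false j (suc n) + w * q ^ j * partial false j n
        ≈⟨ +-cong (partial-false j (suc n) (ℕₚ.m≤n⇒m≤1+n j≤n)) (*-congˡ (partial-false j n j≤n)) ⟩
      (falling j *ₛ c false) (suc n) + w * q ^ j * (falling j *ₛ c false) n
        ≈⟨ sym (*ₛ-step {falling (suc j)} {falling j} {falling j} (c false) (w * q ^ j)
             (sym (falling-0 j)) (λ _ → refl) n) ⟩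
      (falling (suc j) *ₛ c false) (suc n) ∎

    normalise-cong : ∀ {f g : Series} n → f n ≈ g n → normalise f n ≈ normalise g n
    normalise-cong n p = *-congʳ (*-congˡ p)

    A-true : normalise (A true) ≋ exp-q *ₛ normalise (c true)
    A-true = coefficientwise λ n → trans
      (normalise-cong {A true} {rising n 0 *ₛ c true} n (trans (sym (A-sum true n)) (partial-true n 0)))
      (normalise-* (rising n 0) (c true) (λ _ → 1#) n λ { k d ≡.refl → trans (rising-closed k d 0)
        (*-congʳ (trans (^-congˡ k (*-identityʳ w)) (sym (*-identityʳ _)))) })

    A-false : normalise (A false) ≋ Exp-q *ₛ normalise (c false)
    A-false = coefficientwise λ n → trans
      (normalise-cong {A false} {falling n *ₛ c false} n (trans (sym (A-sum false n))
        (trans (+-congˡ (*-congˡ (sym (part-false-end (Y false n))))) (partial-false n n ℕₚ.≤-refl))))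
      (normalise-* (falling n) (c false) (λ k → q ^ (k C 2)) n λ { k d ≡.refl → falling-closed k d })

    a₀ u : Carrier
    u  = 1# - v
    a₀ = s * u

    u+v≈1 : u + v ≈ 1#
    u+v≈1 = trans (+-assoc 1# _ v) (trans (+-congˡ (-‿inverseˡ v)) (+-identityʳ 1#))

    private
      normalise-0 : ∀ f → normalise f 0 ≈ f 0
      normalise-0 f = trans (trans (*-assoc 1# (f 0) _) (*-identityˡ _))
        (trans (*-congˡ (trans (sym (*-identityˡ _)) (F*F⁻¹ 0))) (*-identityʳ (f 0)))

    -- Beyond the constant term `c d` is `v` times `A (not d)` by definition. Both have constant
    -- term `a₀`, and the discrepancy `a₀ - v a₀` is the added constant.
    c-normalised : ∀ d → normalise (c d) ≋ const v *ₛ normalise (A (not d)) +ₛ const (a₀ * u)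
    c-normalised d = coefficientwise λ n → trans (go n) (+-congʳ (sym (const-*ₛ v (normalise (A (not d))) n)))
      where
      go : ∀ n → normalise (c d) n ≈ v * normalise (A (not d)) n + const (a₀ * u) n
      go zero    = begin
        normalise (c d) 0                          ≈⟨ normalise-0 (c d) ⟩
        a₀                                         ≈⟨ sym (trans (*-congˡ u+v≈1) (*-identityʳ a₀)) ⟩
        a₀ * (u + v)                               ≈⟨ solve 3 (λ a u v → a :* (u :+ v) := v :* a :+ a :* u) refl a₀ u v ⟩
        v * a₀ + a₀ * u                            ≈⟨ +-congʳ (*-congˡ (sym (normalise-0 (A (not d))))) ⟩
        v * normalise (A (not d)) 0 + a₀ * u       ∎
      go (suc n) = trans
        (solve 5 (λ W v w T F → W :* (v :* w :* T) :* F := v :* (W :* (w :* T) :* F)) refl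
          (W ^ suc n) v w (T (not d) n) (F⁻¹ (suc n)))
        (sym (+-identityʳ _))

    Q : Series
    Q = Σ≥1 λ n → W ^ n * P n q s / qFactorial q n [ F-unit n ]

    A-normalised : normalise (A true) ≋ const a₀ +ₛ const w *ₛ Q
    A-normalised = coefficientwise λ n → trans (go n) (+-congˡ (sym (const-*ₛ w Q n)))
      where
      go : ∀ n → normalise (A true) n ≈ const a₀ n + w * Q n
      go zero    = trans (normalise-0 (A true)) (sym (trans (+-congˡ (zeroʳ w)) (+-identityʳ a₀)))
      go (suc n) = trans
        (*-congʳ (*-congˡ (*-congˡ (sumList-cong (permutations (suc n)) λ π →
          *-congˡ (reflexive (≡.cong (s ^_) (≡.sym (udr-runs π))))))))
        (trans
          (solve 4 (λ W w T F → W :* (w :* T) :* F := w :* (W :* T :* F)) refl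
            (W ^ suc n) w (P (suc n) q s) (F⁻¹ (suc n)))
          (sym (+-identityˡ _)))

    private
      D û : Series
      D = 1ₛ S.- const (v ^ 2) *ₛ exp-q *ₛ Exp-q
      û = 1ₛ S.- const v

      const-u : const u ≋ û
      const-u = S.trans (coefficientwise (const-+ 1# (- v))) (S.+-congˡ (coefficientwise (const-neg v)))

      const-v² : const (v ^ 2) ≋ const v *ₛ const v
      const-v² = S.trans (coefficientwise (const-cong (*-congˡ (*-identityʳ v)))) (coefficientwise (const-* v v))

      c≋ : ∀ d → normalise (c d) ≋ const v *ₛ normalise (A (not d)) +ₛ const a₀ *ₛ û
      c≋ d = S.trans (c-normalised d) (S.+-congˡ (S.trans (coefficientwise (const-* a₀ u)) (S.*-congˡ const-u)))

    identity : D *ₛ (1ₛ +ₛ const κ *ₛ Q) ≋ û *ₛ (1ₛ +ₛ const v *ₛ exp-q)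
    identity = Elimination.eliminate seriesRing
      {exp-q} {Exp-q} {const v} {û} {const a₀} {const w} {const W} {const κ}
      {normalise (A true)} {normalise (A false)} {Q} {D}
      (S.trans A-true (S.*-congˡ (c≋ true)))
      (S.trans A-false (S.*-congˡ (c≋ false)))
      A-normalised
      (Elimination.x-y+y≈x seriesRing 1ₛ (const v))
      (S.trans (S.+-congʳ (S.*-congʳ (S.*-congʳ (S.sym const-v²))))
        (S.trans (S.+-comm _ D) (Elimination.x-y+y≈x seriesRing 1ₛ (const (v ^ 2) *ₛ exp-q *ₛ Exp-q))))
      (S.trans (S.sym (coefficientwise (const-* W w))) (coefficientwise (const-cong Ww≈1)))
      (S.trans (S.*-congʳ (S.sym (coefficientwise (const-* κ W))))
        (S.trans (S.sym (coefficientwise (const-* (κ * W) a₀))) (coefficientwise (const-cong κWsu≈v))))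

  -- The explicit fractions enter through equations with cleared denominators, so the same argument
  -- serves both coefficient rings.
  module Parametrised (q v s w W κ : Carrier) (F-unit : ∀ n → Unit (qFactorial q n))
    (2-unit : Unit (1# + 1#)) (1+v²-unit : Unit (1# + v ^ 2)) (1-v²-unit : Unit (1# - v ^ 2))
    (s-eq : s * (1# + v ^ 2) ≈ (1# + 1#) * v) (w-eq : w * (1# + v ^ 2) ≈ 1# - v ^ 2)
    (W-eq : W * (1# - v ^ 2) ≈ 1# + v ^ 2) (κ-eq : κ * (1# + 1#) ≈ 1# + v) where

    open Elimination R

    private
      z h : Carrier
      z = 1# - v ^ 2
      h = 1# + v ^ 2

      z+v²≈1 : z + v ^ 2 ≈ 1#
      z+v²≈1 = x-y+y≈x 1# (v ^ 2)

      w+vs≈1 : w + v * s ≈ 1#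
      w+vs≈1 = unit-cancelˡ _ _ 1+v²-unit (begin
        h * (w + v * s)                    ≈⟨ solve 4 (λ h w v s → h :* (w :+ v :* s) := w :* h :+ v :* (s :* h)) refl h w v s ⟩
        w * h + v * (s * h)                ≈⟨ +-cong w-eq (*-congˡ s-eq) ⟩
        z + v * ((1# + 1#) * v)            ≈⟨ solve 2 (λ z v → z :+ v :* (con 2 :* v) := z :+ v :* (v :* con 1) :+ v :* (v :* con 1)) refl z v ⟩
        z + v ^ 2 + v ^ 2                  ≈⟨ +-congʳ z+v²≈1 ⟩
        h                                  ≈⟨ sym (*-identityʳ h) ⟩
        h * 1#                             ∎)

      s≈v+vw : s ≈ v + v * w
      s≈v+vw = unit-cancelˡ _ _ 1+v²-unit (begin
        h * s                      ≈⟨ trans (*-comm h s) s-eq ⟩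
        (1# + 1#) * v              ≈⟨ solve 1 (λ v → con 2 :* v := v :+ v :* con 1) refl v ⟩
        v + v * 1#                 ≈⟨ +-congˡ (*-congˡ (sym z+v²≈1)) ⟩
        v + v * (z + v ^ 2)        ≈⟨ +-congˡ (*-congˡ (+-congʳ (sym w-eq))) ⟩
        v + v * (w * h + v ^ 2)    ≈⟨ solve 2 (λ v w → v :+ v :* (w :* (con 1 :+ v :* (v :* con 1)) :+ v :* (v :* con 1)) :=
                                                       (con 1 :+ v :* (v :* con 1)) :* (v :+ v :* w)) refl v w ⟩
        h * (v + v * w)            ∎)

    Ww≈1 : W * w ≈ 1#
    Ww≈1 = unit-cancelˡ _ _ 1-v²-unit (begin
      z * (W * w)  ≈⟨ solve 3 (λ z W w → z :* (W :* w) := w :* (W :* z)) refl z W w ⟩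
      w * (W * z)  ≈⟨ trans (*-congˡ W-eq) w-eq ⟩
      z            ≈⟨ sym (*-identityʳ z) ⟩
      z * 1#       ∎)

    private
      u : Carrier
      u = 1# - v

      [1+v]u≈z : (1# + v) * u ≈ z
      [1+v]u≈z = Algebra.Properties.Ring.+-cancelʳ ring (v ^ 2) _ _ (begin
        (1# + v) * u + v ^ 2    ≈⟨ solve 2 (λ v u → (con 1 :+ v) :* u :+ v :* (v :* con 1) := u :+ v :* (u :+ v)) refl v u ⟩
        u + v * (u + v)         ≈⟨ +-congˡ (trans (*-congˡ (x-y+y≈x 1# v)) (*-identityʳ v)) ⟩
        u + v                   ≈⟨ trans (x-y+y≈x 1# v) (sym z+v²≈1) ⟩
        z + v ^ 2               ∎)

      -- The product of (1+v)/2, (1+v²)/(1-v²), 2v/(1+v²) and 1-v telescopes.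
      κWsu≈v : κ * W * (s * u) ≈ v
      κWsu≈v = unit-cancelˡ _ _ 2-unit (begin
        (1# + 1#) * (κ * W * (s * u))  ≈⟨ solve 5 (λ b k W s u → b :* (k :* W :* (s :* u)) := s :* (W :* (k :* b :* u))) refl (1# + 1#) κ W s u ⟩
        s * (W * (κ * (1# + 1#) * u))  ≈⟨ *-congˡ (*-congˡ (trans (*-congʳ κ-eq) [1+v]u≈z)) ⟩
        s * (W * z)                    ≈⟨ trans (*-congˡ W-eq) s-eq ⟩
        (1# + 1#) * v                  ∎)

    open Identity q v s w W κ w+vs≈1 s≈v+vw Ww≈1 κWsu≈v F-unit public using (identity)

-- Substituting a multiple of x, cancelling x, and quotients

module Rescaling (R : CommutativeRing 0ℓ 0ℓ) where
  open CommutativeRing R hiding (zero)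
  open Algebra.Properties.Ring ring using (-‿distribʳ-*)
  open Algebra.Properties.Semiring.Exp semiring using (_^_)
  open SetoidReasoning setoid
  open Solver commutativeSemiring using (solve; _:=_; _:+_; _:*_; con)
  open PowerSeries R

  module _ (a : Carrier) where

    rescale-cong : ∀ {f g} → f ≋ g → rescale a f ≋ rescale a g
    rescale-cong p = coefficientwise λ n → *-congˡ (at p n)

    rescale-+ : ∀ f g → rescale a (f +ₛ g) ≋ rescale a f +ₛ rescale a g
    rescale-+ f g = coefficientwise λ n → distribˡ (a ^ n) (f n) (g n)

    rescale-neg : ∀ f → rescale a (-ₛ f) ≋ -ₛ rescale a f
    rescale-neg f = coefficientwise λ n → sym (-‿distribʳ-* (a ^ n) (f n))

    rescale-const : ∀ b → rescale a (const b) ≋ const b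
    rescale-const b = coefficientwise λ { zero → *-identityˡ b ; (suc n) → zeroʳ (a ^ suc n) }

    rescale-* : ∀ f g → rescale a (f *ₛ g) ≋ rescale a f *ₛ rescale a g
    rescale-* f g = coefficientwise (go f g)
      where
      go : ∀ f g → rescale a (f *ₛ g) ≐ rescale a f *ₛ rescale a g
      go f g zero    = begin
        1# * (f *ₛ g) 0                   ≈⟨ trans (*-identityˡ _) (*ₛ-zero f g) ⟩
        f 0 * g 0                         ≈⟨ sym (*-cong (*-identityˡ (f 0)) (*-identityˡ (g 0))) ⟩
        rescale a f 0 * rescale a g 0     ≈⟨ sym (*ₛ-zero (rescale a f) (rescale a g)) ⟩
        (rescale a f *ₛ rescale a g) 0    ∎
      go f g (suc n) = begin
        a ^ suc n * (f *ₛ g) (suc n)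
          ≡⟨ ≡.cong (a ^ suc n *_) (*ₛ-suc f g n) ⟩
        a * a ^ n * (f 0 * g (suc n) + (tail f *ₛ g) n)
          ≈⟨ solve 5 (λ a b f g h → a :* b :* (f :* g :+ h) := con 1 :* f :* (a :* b :* g) :+ a :* (b :* h)) refl
               a (a ^ n) (f 0) (g (suc n)) ((tail f *ₛ g) n) ⟩
        rescale a f 0 * rescale a g (suc n) + a * rescale a (tail f *ₛ g) n
          ≈⟨ +-congˡ (*-congˡ (go (tail f) g n)) ⟩
        rescale a f 0 * rescale a g (suc n) + a * (rescale a (tail f) *ₛ rescale a g) n
          ≈⟨ +-congˡ (sym (·ₛ-*ₛ-assoc a (rescale a (tail f)) (rescale a g) n)) ⟩
        rescale a f 0 * rescale a g (suc n) + ((a ·ₛ rescale a (tail f)) *ₛ rescale a g) n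
          ≈⟨ +-congˡ (*ₛ-cong {a ·ₛ rescale a (tail f)} {tail (rescale a f)} {rescale a g} {rescale a g}
               (λ i → sym (*-assoc a (a ^ i) (f (suc i)))) (λ _ → refl) n) ⟩
        rescale a f 0 * rescale a g (suc n) + (tail (rescale a f) *ₛ rescale a g) n
          ≡⟨ ≡.sym (*ₛ-suc (rescale a f) (rescale a g) n) ⟩
        (rescale a f *ₛ rescale a g) (suc n) ∎

  -- `X` is not a unit, but multiplying by it only shifts the coefficients. This divides the
  -- quadratic equation for `v` by `t`.
  X-cancel : ∀ {f g} → X *ₛ f ≋ X *ₛ g → f ≋ g
  X-cancel {f} {g} p = coefficientwise λ n → trans (sym (X*ₛ-suc f n)) (trans (at p (suc n)) (X*ₛ-suc g n))

module Quotients (R : CommutativeRing 0ℓ 0ℓ) where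
  open CommutativeRing R hiding (zero)
  open Algebra.Properties.Ring ring using (+-cancelʳ)
  open Algebra.Properties.Semiring.Exp semiring using (_^_)
  open Division R
  open SetoidReasoning setoid
  open Solver commutativeSemiring using (solve; _:=_; _:+_; _:*_; con)

  /-* : ∀ x {y} (u : Unit y) → x / y [ u ] * y ≈ x
  /-* x {y} (y⁻¹ , y⁻¹y≈1 , _) = trans (*-assoc x y⁻¹ y) (trans (*-congˡ y⁻¹y≈1) (*-identityʳ x))

  /-unique : ∀ {x y z} (u : Unit y) → y * z ≈ x → x / y [ u ] ≈ z
  /-unique {x} {y} {z} (y⁻¹ , y⁻¹y≈1 , _) yz≈x = begin
    x * y⁻¹        ≈⟨ *-congʳ (sym yz≈x) ⟩
    y * z * y⁻¹    ≈⟨ solve 3 (λ y z y′ → y :* z :* y′ := y′ :* y :* z) refl y z y⁻¹ ⟩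
    y⁻¹ * y * z    ≈⟨ trans (*-congʳ y⁻¹y≈1) (*-identityˡ z) ⟩
    z              ∎

  -- With r = √(1 - t²), the equation t v = 1 - r makes v a root of t (1 + v²) = 2 v.
  quadratic : ∀ {t v r} → r * r ≈ 1# - t ^ 2 → t * v ≈ 1# - r →
              t * (t * (1# + v ^ 2)) ≈ t * ((1# + 1#) * v)
  quadratic {t} {v} {r} r²≈ tv≈ = +-cancelʳ r _ _ (begin
    t * (t * (1# + v ^ 2)) + r
      ≈⟨ solve 3 (λ t v r → t :* (t :* (con 1 :+ v :* (v :* con 1))) :+ r := (t :* v) :* (t :* v) :+ t :* (t :* con 1) :+ r :* con 1) refl t v r ⟩
    x * x + t ^ 2 + r * 1#
      ≈⟨ +-congˡ (*-congˡ (sym x+r≈1)) ⟩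
    x * x + t ^ 2 + r * (x + r)
      ≈⟨ solve 3 (λ x t r → x :* x :+ t :+ r :* (x :+ r) := x :* (x :+ r) :+ (r :* r :+ t)) refl x (t ^ 2) r ⟩
    x * (x + r) + (r * r + t ^ 2)
      ≈⟨ +-cong (*-congˡ x+r≈1) (trans (trans (+-congʳ r²≈) (Elimination.x-y+y≈x R 1# (t ^ 2))) (sym x+r≈1)) ⟩
    x * 1# + (x + r)
      ≈⟨ solve 3 (λ t v r → t :* v :* con 1 :+ (t :* v :+ r) := t :* (con 2 :* v) :+ r) refl t v r ⟩
    t * ((1# + 1#) * v) + r ∎)
    where
    x : Carrier
    x = t * v
    x+r≈1 : x + r ≈ 1#
    x+r≈1 = trans (+-congʳ tv≈) (Elimination.x-y+y≈x R 1# r)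

-- The two forms of the identity

module Conclusion (R : CommutativeRing 0ℓ 0ℓ) where
  open CommutativeRing R hiding (zero)
  open Algebra.Properties.Semiring.Exp semiring using (_^_; ^-congˡ)
  open Algebra.Properties.CommutativeSemiring.Exp commutativeSemiring using (^-distrib-*)
  open SetoidReasoning setoid
  open Solver commutativeSemiring using (solve; _:=_; _:*_)
  open PowerSeries R
  open Division R using (Unit; _/_[_])
  open Division seriesRing using () renaming (Unit to Unitₛ; _/_[_] to _/ₛ_[_])
  open QNumbers R using (qFactorial; P)
  open Quotients R
  open Rescaling R

  private
    module S = CommutativeRing seriesRing
  open S using () renaming (_-_ to _-ₛ_)

  module _ (q v s : Carrier) (F-unit : ∀ n → Unit (qFactorial q n))
    (2-unit : Unit (1# + 1#)) (1+v²-unit : Unit (1# + v ^ 2)) (1-v²-unit : Unit (1# - v ^ 2))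
    (s-eq : s * (1# + v ^ 2) ≈ (1# + 1#) * v) where

    open QExponentials R q F-unit

    private
      w W κ : Carrier
      w = (1# - v ^ 2) / (1# + v ^ 2) [ 1+v²-unit ]
      W = (1# + v ^ 2) / (1# - v ^ 2) [ 1-v²-unit ]
      κ = (1# + v) / (1# + 1#) [ 2-unit ]

      module M = RunIdentity.Parametrised R q v s w W κ F-unit 2-unit 1+v²-unit 1-v²-unit s-eq
        (/-* (1# - v ^ 2) 1+v²-unit) (/-* (1# + v ^ 2) 1-v²-unit) (/-* (1# + v) 2-unit)

    first-form : (D-unit : Unitₛ (1ₛ -ₛ const (v ^ 2) *ₛ exp-q *ₛ Exp-q)) →
      ((1ₛ -ₛ const v) *ₛ (1ₛ +ₛ const v *ₛ exp-q)) /ₛ (1ₛ -ₛ const (v ^ 2) *ₛ exp-q *ₛ Exp-q) [ D-unit ] ≋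
      1ₛ +ₛ const κ *ₛ Σ≥1 (λ n → W ^ n * P n q s / qFactorial q n [ F-unit n ])
    first-form D-unit = Quotients./-unique seriesRing D-unit M.identity

    private
      Q : Series
      Q = Σ≥1 λ n → W ^ n * P n q s / qFactorial q n [ F-unit n ]

      Q′ : Series
      Q′ = Σ≥1 λ n → P n q s / qFactorial q n [ F-unit n ]

      e E : Series
      e = rescale w exp-q
      E = rescale w Exp-q

      rescale-Q : rescale w Q ≋ Q′
      rescale-Q = coefficientwise λ
        { zero → zeroʳ 1#
        ; (suc n) → begin
            w ^ suc n * (W ^ suc n * P (suc n) q s * F⁻¹ (suc n))
              ≈⟨ solve 4 (λ w W x f → w :* (W :* x :* f) := W :* w :* (x :* f)) refl (w ^ suc n) (W ^ suc n) _ _ ⟩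
            W ^ suc n * w ^ suc n * (P (suc n) q s * F⁻¹ (suc n))
              ≈⟨ *-congʳ (trans (sym (^-distrib-* W w (suc n))) (trans (^-congˡ (suc n) M.Ww≈1) (Expansion.1^n≈1 R q w (suc n)))) ⟩
            1# * (P (suc n) q s * F⁻¹ (suc n))
              ≈⟨ *-identityˡ _ ⟩
            P (suc n) q s * F⁻¹ (suc n) ∎
        }
        where
        F⁻¹ : ℕ → Carrier
        F⁻¹ n = proj₁ (F-unit n)

      rescale-1+ : ∀ b f → rescale w (1ₛ +ₛ const b *ₛ f) ≋ 1ₛ +ₛ const b *ₛ rescale w f
      rescale-1+ b f = S.trans (rescale-+ w 1ₛ (const b *ₛ f))
        (S.+-cong (rescale-const w 1#) (S.trans (rescale-* w (const b) f) (S.*-congʳ (rescale-const w b))))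

      rescale-1- : ∀ f → rescale w (1ₛ -ₛ f) ≋ 1ₛ -ₛ rescale w f
      rescale-1- f = S.trans (rescale-+ w 1ₛ (-ₛ f)) (S.+-cong (rescale-const w 1#) (rescale-neg w f))

      rescaled : (1ₛ -ₛ const (v ^ 2) *ₛ e *ₛ E) *ₛ (1ₛ +ₛ const κ *ₛ Q′) ≋
                 (1ₛ -ₛ const v) *ₛ (1ₛ +ₛ const v *ₛ e)
      rescaled = S.trans
        (S.sym (S.trans (rescale-* w _ _) (S.*-cong
          (S.trans (rescale-1- _) (S.+-congˡ (S.-‿cong (S.trans (rescale-* w _ _)
            (S.*-congʳ (S.trans (rescale-* w _ _) (S.*-congʳ (rescale-const w (v ^ 2)))))))))
          (S.trans (rescale-1+ κ Q) (S.+-congˡ (S.*-congˡ rescale-Q))))))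
        (S.trans (rescale-cong w M.identity)
          (S.trans (rescale-* w _ _) (S.*-cong
            (S.trans (rescale-1- _) (S.+-congˡ (S.-‿cong (rescale-const w v))))
            (rescale-1+ v exp-q))))

    second-form : (1+v-unit : Unit (1# + v)) (D-unit : Unitₛ (1ₛ -ₛ const (v ^ 2) *ₛ rescale w exp-q *ₛ rescale w Exp-q)) →
      Σ≥1 (λ n → P n q s / qFactorial q n [ F-unit n ]) ≋
      const ((1# + 1#) / (1# + v) [ 1+v-unit ]) *ₛ
        (((1ₛ -ₛ const v) *ₛ (1ₛ +ₛ const v *ₛ rescale w exp-q))
          /ₛ (1ₛ -ₛ const (v ^ 2) *ₛ rescale w exp-q *ₛ rescale w Exp-q) [ D-unit ] -ₛ 1ₛ)
    second-form 1+v-unit D-unit = S.sym (S.trans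
      (S.*-congˡ (S.trans (S.+-congʳ (Quotients./-unique seriesRing D-unit rescaled)) (1+x-1≈x (const κ *ₛ Q′))))
      (S.trans (S.sym (S.*-assoc _ _ _)) (S.trans
        (S.*-congʳ (S.trans (S.sym (coefficientwise (const-* λ′ κ))) (coefficientwise (const-cong λκ≈1))))
        (S.*-identityˡ Q′))))
      where
      λ′ : Carrier
      λ′ = (1# + 1#) / (1# + v) [ 1+v-unit ]

      -- The prefactor 2/(1+v) of the second form inverts the factor (1+v)/2 of the first, isolating
      -- the sum.
      λκ≈1 : λ′ * κ ≈ 1#
      λκ≈1 = Elimination.unit-cancelˡ R _ _ 2-unit (begin
        (1# + 1#) * (λ′ * κ)  ≈⟨ solve 3 (λ b l k → b :* (l :* k) := l :* (k :* b)) refl (1# + 1#) λ′ κ ⟩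
        λ′ * (κ * (1# + 1#))  ≈⟨ trans (*-congˡ (/-* (1# + v) 2-unit)) (/-* (1# + 1#) 1+v-unit) ⟩
        1# + 1#               ≈⟨ sym (*-identityʳ _) ⟩
        (1# + 1#) * 1#        ∎)

      1+x-1≈x : ∀ f → (1ₛ +ₛ f) -ₛ 1ₛ ≋ f
      1+x-1≈x f = S.trans (S.+-congʳ (S.+-comm 1ₛ f)) (S.trans (S.+-assoc f 1ₛ _)
        (S.trans (S.+-congˡ (S.-‿inverseʳ 1ₛ)) (S.+-identityʳ f)))

theorem4p14 : (let open OverRationalFunctions in
    ((1ₛ -ₛ const t) *ₛ (1ₛ +ₛ const t *ₛ exp-q))
    /ₛ (1ₛ -ₛ const (t ^ 2) *ₛ exp-q *ₛ Exp-q) [ 1-t²eE-unit ]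
    ≋ 1ₛ +ₛ const ((1# + t) / 2# [ 2-unit ])
    *ₛ Σ≥1 (λ n → ((1# + t ^ 2) / (1# - t ^ 2) [ 1-t²-unit ]) ^ n
    * P n q (2# * t / (1# + t ^ 2) [ 1+t²-unit ])
    / qFactorial q n [ qFactorial-unit n ]))
    ×
    (let open OverPowerSeries in
    Σ≥1 (λ n → P n q t / qFactorial q n [ qFactorial-unit n ])
    ≋ const (2# / (1# + v) [ 1+v-unit ])
    *ₛ (((1ₛ -ₛ const v) *ₛ (1ₛ +ₛ const v *ₛ rescale w exp-q))
    /ₛ (1ₛ -ₛ const (v ^ 2) *ₛ rescale w exp-q *ₛ rescale w Exp-q) [ 1-v²eE-unit ]
    -ₛ 1ₛ))
theorem4p14 =
    (let open OverRationalFunctions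
         R = RationalFunctions.fractionRing ℚ⟨q⟩
     in Conclusion.first-form R q t (2# * t / (1# + t ^ 2) [ 1+t²-unit ]) qFactorial-unit
          2-unit 1+t²-unit 1-t²-unit (Quotients./-* R (2# * t) 1+t²-unit) 1-t²eE-unit)
  , (let open OverPowerSeries
         K = Field.commutativeRing ℚ⟨q⟩
         R = PowerSeries.seriesRing K
     in Conclusion.second-form R q v t qFactorial-unit 2-unit 1+v²-unit 1-v²-unit
          -- Here `s` is `t` itself, so the relation `s (1 + v²) = 2 v` must be extracted from the
          -- definition of `v` by the square root.
          (Rescaling.X-cancel K (Quotients.quadratic R {t} {v} {√[1-t²]} √[1-t²]-square t*v))
          1+v-unit 1-v²eE-unit)
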